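{- Let $q$ be an even prime power, let $\mathrm{AG}(3,q)$ be completed to $\mathrm{PG}(3,q)$ by the plane at infinity $\pi_\infty$, and let $\mathcal{C}$ be a non-singular conic in $\pi_\infty$. Let $\mathcal{L}$ be a Kakeya line set in $T^{*}_{2}(\mathcal{C})$ with corresponding Kakeya set $\mathcal{K}(\mathcal{L})$. If $|\mathcal{K}(\mathcal{L})|<\frac34 q^2+q-1$, then $\mathcal{K}(\mathcal{L})$ is a Kakeya set of the following type: there exist a hyperbolic quadric $\mathcal{Q}$ of $\mathrm{PG}(3,q)$ with $\mathcal{Q}\cap\pi_\infty=\mathcal{C}$, with reguli $\mathcal{R}$ and $\mathcal{R}'$, and a partition of the points of $\mathcal{C}$ into two (possibly empty) sets $A$ and $B$, such that $\mathcal{K}(\mathcal{L})$ is the set of affine points covered by the Kakeya line set consisting of the (affine parts of the) lines of $\mathcal{R}$ through the points of $A$ and the lines of $\mathcal{R}'$ through the points of $B$.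
   Context: The linear representation $T^{*}_{2}(\mathcal{C})$ is the point-line geometry whose points are the points of $\mathrm{AG}(3,q)$, whose lines are the lines of $\mathrm{AG}(3,q)$ whose direction (point at infinity) lies in $\mathcal{C}$, with incidence inherited from $\mathrm{AG}(3,q)$. A Kakeya line set in $T^{*}_{2}(\mathcal{C})$ is a set of lines of $T^{*}_{2}(\mathcal{C})$ containing precisely one line through each point of $\mathcal{C}$; its Kakeya set $\mathcal{K}(\mathcal{L})$ is the set of affine points covered by its lines. A hyperbolic quadric in $\mathrm{PG}(3,q)$ is a quadric projectively equivalent to $X_0X_1+X_2X_3=0$; its $2(q+1)$ lines split into two reguli $\mathcal{R},\mathcal{R}'$ of $q+1$ pairwise disjoint lines each, every line of $\mathcal{R}$ meeting every line of $\mathcal{R}'$. If $\mathcal{Q}\cap\pi_\infty=\mathcal{C}$, each point of $\mathcal{C}$ lies on exactly one line of $\mathcal{R}$ and one line of $\mathcal{R}'$. -}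

module Defs where

open import Level using (0ℓ)
open import Data.Nat as ℕ using (ℕ)
open import Data.Fin using (Fin; zero; suc)
open import Data.Product using (Σ; ∃; _×_; _,_)
open import Data.Sum using (_⊎_)
open import Data.List using (List)
open import Data.List.Relation.Unary.Any using (Any)
open import Data.List.Relation.Unary.AllPairs using (AllPairs)
open import Relation.Nullary using (¬_)
open import Relation.Binary.PropositionalEquality using (_≡_; _≢_)
open import Algebra.Structures using (IsCommutativeRing)
open import Function.Bundles using (_↔_; _⇔_)

-- A finite field of order q (propositional equality on the carrier).
-- Every finite field has prime-power order, so "GF(q)" is any such field.

record FiniteField (q : ℕ) : Set₁ where
  infixl 6 _+_
  infixl 7 _*_
  infix  8 -_
  field
    Carrier           : Set
    _+_ _*_           : Carrier → Carrier → Carrier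
    -_                : Carrier → Carrier
    0# 1#             : Carrier
    isCommutativeRing : IsCommutativeRing _≡_ _+_ _*_ -_ 0# 1#
    0≢1               : 0# ≢ 1#
    inverse           : ∀ x → x ≢ 0# → ∃ λ y → x * y ≡ 1#
    enumeration       : Fin q ↔ Carrier

-- Geometry of PG(3,q) = AG(3,q) ∪ π∞, homogeneous coordinates
-- (X0,X1,X2,X3), π∞ : X0 = 0, affine point x ↦ (1,x0,x1,x2),
-- direction d ↦ point at infinity (0,d0,d1,d2).

module Geom {q : ℕ} (𝔽 : FiniteField q) where
  open FiniteField 𝔽 public

  Vec : ℕ → Set
  Vec n = Fin n → Carrier

  _≐_ : ∀ {n} → Vec n → Vec n → Set
  u ≐ v = ∀ i → u i ≡ v i

  NonZero : ∀ {n} → Vec n → Set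
  NonZero v = ¬ (∀ i → v i ≡ 0#)

  _∝_ : ∀ {n} → Vec n → Vec n → Set
  u ∝ v = ∃ λ c → c ≢ 0# × (∀ i → u i ≡ c * v i)

  record TernaryForm : Set where
    field c00 c11 c22 c01 c02 c12 : Carrier

    form : Vec 3 → Carrier
    form x = c00 * x zero * x zero + c11 * x (suc zero) * x (suc zero)
           + c22 * x (suc (suc zero)) * x (suc (suc zero))
           + c01 * x zero * x (suc zero) + c02 * x zero * x (suc (suc zero))
           + c12 * x (suc zero) * x (suc (suc zero))

    ∂0 ∂1 ∂2 : Vec 3 → Carrier
    ∂0 x = (c00 + c00) * x zero + c01 * x (suc zero) + c02 * x (suc (suc zero))
    ∂1 x = c01 * x zero + (c11 + c11) * x (suc zero) + c12 * x (suc (suc zero))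
    ∂2 x = c02 * x zero + c12 * x (suc zero) + (c22 + c22) * x (suc (suc zero))

  open TernaryForm public

  NonSingular : TernaryForm → Set
  NonSingular C = ∀ x → NonZero x → form C x ≡ 0# →
    ¬ (∂0 C x ≡ 0# × ∂1 C x ≡ 0# × ∂2 C x ≡ 0#)

  OnConic : TernaryForm → Vec 3 → Set
  OnConic C d = NonZero d × form C d ≡ 0#

  record AffLine : Set where
    constructor line
    field base dir : Vec 3

  open AffLine public

  OnLine : Vec 3 → AffLine → Set
  OnLine x ℓ = ∃ λ t → ∀ i → x i ≡ base ℓ i + t * dir ℓ i

  SameLine : AffLine → AffLine → Set
  SameLine ℓ ℓ' = ∀ x → OnLine x ℓ ⇔ OnLine x ℓ'

  -- A set 𝓛 of lines of T*₂(C) (a line is given by any of its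
  -- representations; 𝓛 is the set of point sets of its members)
  -- containing precisely one line through each point of C.
  IsKakeyaLineSet : TernaryForm → (AffLine → Set) → Set
  IsKakeyaLineSet C 𝓛 =
      (∀ ℓ → 𝓛 ℓ → OnConic C (dir ℓ))
    × (∀ d → OnConic C d → ∃ λ ℓ → 𝓛 ℓ × dir ℓ ∝ d)
    × (∀ d ℓ ℓ' → OnConic C d → 𝓛 ℓ → 𝓛 ℓ' → dir ℓ ∝ d → dir ℓ' ∝ d →
         SameLine ℓ ℓ')

  KakeyaSet : (AffLine → Set) → Vec 3 → Set
  KakeyaSet 𝓛 x = ∃ λ ℓ → 𝓛 ℓ × OnLine x ℓ

  Enumerates : (Vec 3 → Set) → List (Vec 3) → Set
  Enumerates P xs = AllPairs (λ x y → ¬ (x ≐ y)) xs × (∀ x → P x ⇔ Any (x ≐_) xs)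

  Mat4 : Set
  Mat4 = Fin 4 → Fin 4 → Carrier

  apply : Mat4 → Vec 4 → Vec 4
  apply M v i = M i zero * v zero + M i (suc zero) * v (suc zero)
              + M i (suc (suc zero)) * v (suc (suc zero))
              + M i (suc (suc (suc zero))) * v (suc (suc (suc zero)))

  Invertible : Mat4 → Set
  Invertible M = ∃ λ N → ∀ v → apply N (apply M v) ≐ v × apply M (apply N v) ≐ v

  hyp : Vec 4 → Carrier
  hyp X = X zero * X (suc zero) + X (suc (suc zero)) * X (suc (suc (suc zero)))

  -- Parametrisation of the zeros of X0X1+X2X3 as rank-one 2×2 matrices:
  -- the regulus R_std consists of the lines {φ u v : v} (u fixed),
  -- the opposite regulus R'_std of the lines {φ u v : u} (v fixed).
  φ : Vec 2 → Vec 2 → Vec 4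
  φ u v zero                   = u zero * v zero
  φ u v (suc zero)             = u (suc zero) * v (suc zero)
  φ u v (suc (suc zero))       = u zero * v (suc zero)
  φ u v (suc (suc (suc zero))) = - (u (suc zero) * v zero)

  -- The hyperbolic quadric Q_M = {X : hyp (M X) = 0} (image of the
  -- standard one under the projectivity M⁻¹), with reguli R_M, R'_M.
  -- CommonR M P X : the points P, X lie on a common line of R_M.
  CommonR : Mat4 → Vec 4 → Vec 4 → Set
  CommonR M P X = ∃ λ u → NonZero u × ∃ λ v → ∃ λ v' →
    apply M P ≐ φ u v × apply M X ≐ φ u v'

  CommonR' : Mat4 → Vec 4 → Vec 4 → Set
  CommonR' M P X = ∃ λ v → NonZero v × ∃ λ u → ∃ λ u' →
    apply M P ≐ φ u v × apply M X ≐ φ u' v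

  atInfinity : Vec 3 → Vec 4
  atInfinity d zero    = 0#
  atInfinity d (suc i) = d i

  affinePt : Vec 3 → Vec 4
  affinePt x zero    = 1#
  affinePt x (suc i) = x i

{-# OPTIONS --safe #-}
module Submission where

-- Two lines of the Kakeya line set meet in at most one point, and since no three points
-- of a conic are collinear, three pairwise meeting lines are concurrent. Join each line
-- to the first line through each of its points: this gives a triangle-free graph on
-- q + 1 vertices with at least q (q + 1) - |K| > q²/4 + 1 edges. Such a graph is bipartite,
-- and each part has two vertices joined to the whole other part.
--
-- In characteristic 2 the conic is y² = xz in suitable coordinates, with nucleus
-- (0, 1, 0). The line with direction (s², st, t²) is {tx + sy = m, ty + sz = k}, and two
-- lines meet iff the points (s, t, m, k) are orthogonal for a symplectic form. Hence one
-- part of the graph lies on a hyperbolic line m = αs + βt, k = γs + δt, and the other on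
-- its polar m = δs + βt, k = γs + αt. These are the two reguli of the quadric
-- (x + β)(z + γ) = (y + α)(y + δ), where α ≠ δ because the lines are not concurrent.

open import Defs
open import Data.Nat as ℕ using (ℕ; zero; suc; _^_; z≤n; s≤s)
import Data.Nat.Properties as ℕₚ
open import Data.Nat.Tactic.RingSolver using (solve-∀)
open import Data.Fin as Fin using (Fin; zero; suc)
import Data.Fin.Properties as Finₚ
open import Data.Product using (∃; _×_; _,_; proj₁; proj₂)
open import Data.List using (List; length; lookup)
open import Data.List.Relation.Unary.Any using (index)
open import Data.List.Relation.Unary.Any.Properties using (lookup-index)
open import Data.Sum using (_⊎_; inj₁; inj₂; [_,_]′)
open import Data.Empty using (⊥)
open import Relation.Nullary using (¬_; Dec; yes; no; ¬?; contradiction)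
open import Relation.Nullary.Decidable using (map′; _×-dec_; _⊎-dec_; _→-dec_; decidable-stable; toSum)
open import Relation.Binary.PropositionalEquality
open import Relation.Binary.Definitions using (tri<; tri≈; tri>)
open import Algebra.Properties.Semiring.Sum ℕₚ.+-*-semiring
  using (sum; sum-syntax; ∑-comm; ∑-distrib-+; sum-cong-≗; *-distribˡ-sum; *-distribʳ-sum)
open import Level using (0ℓ)
open import Data.Bool using (Bool; true; false)
open import Data.Bool.Properties using (xor-∧-commutativeRing)
open import Data.Fin.Patterns using (0F; 1F; 2F; 3F)
open import Data.Fin.Permutation using (Permutation; permutation)
open import Data.Maybe using (Maybe; just; nothing)
open import Function.Bundles using (Inverse; _⇔_; mk⇔; Equivalence)
open import Algebra.Bundles using (CommutativeRing)
open import Algebra.Solver.Ring.AlmostCommutativeRing using (AlmostCommutativeRing; fromCommutativeRing; _-Raw-AlmostCommutative⟶_)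
import Algebra.Properties.CommutativeMonoid.Sum
import Algebra.Properties.Semiring.Mult
import Algebra.Solver.Ring

-- Joining all pairs of meeting lines would turn the r lines through a point into a clique. Joining
-- each only to the first one gives a star with r - 1 edges, which has no triangle and still records
-- every repeated covering of the point. The threshold 3q²/4 + q - 1 is q (q + 1) minus q²/4 + 1,
-- and q²/4 + 1 bounds a (b - 1) + 1 whenever a + (b - 1) = q. This number arises twice: as a bound
-- on the edges of a triangle-free graph that is not bipartite, and as a bound on the edges of a
-- bipartite graph in which at most one vertex of a part is joined to the whole other part. Two
-- fully joined vertices per part suffice because two points of PG(3,q) span a line, whose polar is
-- again a line: the two vertices of one part confine the other part to a polar line, and two
-- vertices of that part confine the former in turn. Edges missing elsewhere never have to be
-- examined.

module Counting where
  open import Data.Nat using (_+_; _*_; _≤_; _<_)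
  open ℕₚ

  -- Indicator sums and the bound on the number of edges.

  𝟙 : ∀ {p} {P : Set p} → Dec P → ℕ
  𝟙 (yes _) = 1
  𝟙 (no _)  = 0

  𝟙≤1 : ∀ {p} {P : Set p} (d : Dec P) → 𝟙 d ≤ 1
  𝟙≤1 (yes _) = s≤s z≤n
  𝟙≤1 (no _)  = z≤n

  𝟙-yes : ∀ {p} {P : Set p} (d : Dec P) → P → 𝟙 d ≡ 1
  𝟙-yes (yes _) _ = refl
  𝟙-yes (no ¬p) p = contradiction p ¬p

  𝟙-no : ∀ {p} {P : Set p} (d : Dec P) → ¬ P → 𝟙 d ≡ 0
  𝟙-no (yes p) ¬p = contradiction p ¬p
  𝟙-no (no _)  _  = refl

  𝟙-mono : ∀ {p q} {P : Set p} {Q : Set q} (d : Dec P) (e : Dec Q) → (P → Q) → 𝟙 d ≤ 𝟙 e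
  𝟙-mono (yes p) e f = ≤-reflexive (sym (𝟙-yes e (f p)))
  𝟙-mono (no _)  e f = z≤n

  𝟙≢0 : ∀ {p} {P : Set p} (d : Dec P) → 𝟙 d ≢ 0 → P
  𝟙≢0 (yes p) _ = p
  𝟙≢0 (no _) ne = contradiction refl ne

  𝟙-complement : ∀ {p} {P : Set p} (d : Dec P) → 𝟙 (¬? d) + 𝟙 d ≡ 1
  𝟙-complement (yes _) = refl
  𝟙-complement (no _)  = refl

  sum-mono : ∀ {n} (f g : Fin n → ℕ) → (∀ i → f i ≤ g i) → sum f ≤ sum g
  sum-mono {zero}  f g le = z≤n
  sum-mono {suc n} f g le =
    +-mono-≤ (le zero) (sum-mono (λ i → f (suc i)) (λ i → g (suc i)) (λ i → le (suc i)))

  sum-zero : ∀ {n} (f : Fin n → ℕ) → (∀ i → f i ≡ 0) → sum f ≡ 0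
  sum-zero {zero}  f eq = refl
  sum-zero {suc n} f eq = cong₂ _+_ (eq zero) (sum-zero (λ i → f (suc i)) (λ i → eq (suc i)))

  term≤sum : ∀ {n} (f : Fin n → ℕ) i → f i ≤ sum f
  term≤sum f zero    = m≤m+n _ _
  term≤sum f (suc i) = ≤-trans (term≤sum (λ j → f (suc j)) i) (m≤n+m _ _)

  sum-const : ∀ n c → ∑[ i < n ] c ≡ n * c
  sum-const zero    c = refl
  sum-const (suc n) c = cong (c +_) (sum-const n c)

  sum-𝟙≡ : ∀ {n} (i : Fin n) c → ∑[ j < n ] (𝟙 (j Fin.≟ i) * c) ≡ c
  sum-𝟙≡ {suc n} zero c = begin
    c + 0 + ∑[ j < n ] (𝟙 (suc j Fin.≟ zero) * c)
      ≡⟨ cong (c + 0 +_) (sum-zero {n} (λ j → 𝟙 (suc j Fin.≟ zero) * c) (λ j → refl)) ⟩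
    c + 0 + 0
      ≡⟨ trans (+-identityʳ _) (+-identityʳ _) ⟩
    c ∎
    where open ≡-Reasoning
  sum-𝟙≡ {suc n} (suc i) c =
    trans (sum-cong-≗ {n} λ j → cong (_* c) (lem j)) (sum-𝟙≡ i c)
    where
    lem : ∀ j → 𝟙 (suc j Fin.≟ suc i) ≡ 𝟙 (j Fin.≟ i)
    lem j with j Fin.≟ i
    ... | yes p = refl
    ... | no p  = refl

  sum-𝟙≡-unit : ∀ {n} (i : Fin n) → ∑[ j < n ] 𝟙 (j Fin.≟ i) ≡ 1
  sum-𝟙≡-unit {n} i =
    trans (sum-cong-≗ {n} (λ j → sym (*-identityʳ _))) (sum-𝟙≡ i 1)

  sum-positive : ∀ {n} (f : Fin n → ℕ) → sum f ≢ 0 → ∃ λ i → f i ≢ 0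
  sum-positive f ne with Finₚ.any? (λ i → ¬? (f i ≟ 0))
  ... | yes p = p
  ... | no ¬p = contradiction (sum-zero f vanish) ne
    where
    vanish : ∀ i → f i ≡ 0
    vanish i with f i ≟ 0
    ... | yes e = e
    ... | no e  = contradiction (i , e) ¬p

  sum≤1 : ∀ {n} (f : Fin n → ℕ) → (∀ i → f i ≤ 1) →
          (∀ i j → f i ≢ 0 → f j ≢ 0 → i ≡ j) → sum f ≤ 1
  sum≤1 {n} f f≤1 unique with Finₚ.any? (λ i → ¬? (f i ≟ 0))
  ... | no ¬p = ≤-trans (≤-reflexive (sum-zero f vanish)) z≤n
    where
    vanish : ∀ i → f i ≡ 0
    vanish i with f i ≟ 0
    ... | yes e = e
    ... | no e  = contradiction (i , e) ¬p
  ... | yes (i , fi≢0) = ≤-trans (sum-mono f (λ j → 𝟙 (j Fin.≟ i)) le) (≤-reflexive (sum-𝟙≡-unit i))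
    where
    le : ∀ j → f j ≤ 𝟙 (j Fin.≟ i)
    le j with j Fin.≟ i
    ... | yes _ = f≤1 j
    ... | no j≢i with f j ≟ 0
    ...   | yes e = ≤-reflexive e
    ...   | no e  = contradiction (unique j i e fi≢0) j≢i

  ∑∑≤1 : ∀ {m n} {P : Fin m → Fin n → Set} (P? : ∀ i j → Dec (P i j)) →
         (∀ {i j i' j'} → P i j → P i' j' → i ≡ i' × j ≡ j') →
         ∑[ i < m ] ∑[ j < n ] 𝟙 (P? i j) ≤ 1
  ∑∑≤1 P? unique = sum≤1 _
    (λ i → sum≤1 _ (λ j → 𝟙≤1 (P? i j))
       (λ j j' x y → proj₂ (unique (𝟙≢0 (P? i j) x) (𝟙≢0 (P? i j') y))))
    (λ i i' x y →
       let (j , nz) = sum-positive _ x ; (j' , nz') = sum-positive _ y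
       in proj₁ (unique (𝟙≢0 (P? i j) nz) (𝟙≢0 (P? i' j') nz')))

  -- (b' − a)² ≥ 0, in the form 4ab' ≤ (a + b')².
  four-product : ∀ a b → 4 * (a * b) ≤ (a + b) * (a + b)
  four-product zero b = z≤n
  four-product (suc a) zero = ≤-trans (≤-reflexive (cong (4 *_) (*-zeroʳ a))) z≤n
  four-product (suc a) (suc b) = begin
    4 * (suc a * suc b)                    ≡⟨ eq₁ a b ⟩
    4 * (a * b) + 4 * (a + b + 1)          ≤⟨ +-monoˡ-≤ _ (four-product a b) ⟩
    (a + b) * (a + b) + 4 * (a + b + 1)    ≡⟨ eq₂ a b ⟩
    (suc a + suc b) * (suc a + suc b)      ∎
    where
    open ≤-Reasoning
    eq₁ : ∀ a b → 4 * (suc a * suc b) ≡ 4 * (a * b) + 4 * (a + b + 1)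
    eq₁ = solve-∀
    eq₂ : ∀ a b → (a + b) * (a + b) + 4 * (a + b + 1) ≡ (suc a + suc b) * (suc a + suc b)
    eq₂ = solve-∀

  -- Here `s` is twice a number of edges, and the hypothesis bounds that number by a (b - 1) + 1.
  -- Since a + (b - 1) = q, `four-product` bounds a (b - 1) by q²/4. The case b = 0 is separate
  -- because b - 1 is then not a natural number.
  few-edges : ∀ q s a b → a + b ≡ suc q → s + 2 * a ≤ 2 * (a * b + 1) → 2 * s ≤ q * q + 4
  few-edges q s a zero a+b≡ le = begin
    2 * s     ≤⟨ *-monoʳ-≤ 2 s≤2 ⟩
    4         ≤⟨ m≤n+m 4 (q * q) ⟩
    q * q + 4 ∎
    where
    open ≤-Reasoning
    s≤2 : s ≤ 2
    s≤2 = ≤-trans (m≤m+n s _) (≤-trans le (≤-reflexive (cong (λ z → 2 * (z + 1)) (*-zeroʳ a))))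
  few-edges q s a (suc b) a+b≡ le = begin
    2 * s                   ≤⟨ *-monoʳ-≤ 2 s≤ ⟩
    2 * (2 * (a * b + 1))   ≡⟨ eq' (a * b) ⟩
    4 * (a * b) + 4         ≤⟨ +-monoˡ-≤ 4 (four-product a b) ⟩
    (a + b) * (a + b) + 4   ≡⟨ cong (λ z → z * z + 4) (suc-injective (trans (sym (+-suc a b)) a+b≡)) ⟩
    q * q + 4               ∎
    where
    open ≤-Reasoning
    eq : ∀ a b → 2 * (a * suc b + 1) ≡ 2 * (a * b + 1) + 2 * a
    eq = solve-∀
    eq' : ∀ p → 2 * (2 * (p + 1)) ≡ 4 * p + 4
    eq' = solve-∀
    s≤ : s ≤ 2 * (a * b + 1)
    s≤ = +-cancelʳ-≤ (2 * a) _ _ (≤-trans le (≤-reflexive (eq a b)))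

-- Dense triangle-free graphs on q + 1 vertices.

module DenseGraph (q : ℕ) where
  open Counting
  open import Data.Nat using (_+_; _*_; _≤_; _<_)
  open ℕₚ
  open import Algebra.Properties.CommutativeSemigroup *-commutativeSemigroup using (x∙yz≈y∙xz)

  private
    V : Set
    V = Fin (suc q)

  argmax : ∀ {m} (f : Fin (suc m) → ℕ) → ∃ λ i → ∀ j → f j ≤ f i
  argmax {zero}  f = zero , λ { zero → ≤-refl }
  argmax {suc m} f with argmax (λ i → f (suc i))
  ... | i , max with ≤-total (f zero) (f (suc i))
  ...   | inj₁ le = suc i , λ { zero → le ; (suc j) → max j }
  ...   | inj₂ ge = zero , λ { zero → ≤-refl ; (suc j) → ≤-trans (max j) ge }

  module Bipartite
    {E : V → V → Set} (E? : ∀ x y → Dec (E x y))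
    {A : V → Set} (A? : ∀ x → Dec (A x)) {B : V → Set} (B? : ∀ x → Dec (B x))
    where

    α β : V → ℕ
    α x = 𝟙 (A? x)
    β x = 𝟙 (B? x)

    ε : V → V → ℕ
    ε x y = 𝟙 (E? x y)

    degB : V → ℕ
    degB z = ∑[ w < suc q ] (β w * ε z w)

    edges : ℕ
    edges = ∑[ z < suc q ] (α z * degB z)

    Complete : V → Set
    Complete z = ∀ w → B w → E z w

    complete? : ∀ z → Dec (Complete z)
    complete? z = Finₚ.all? λ w → B? w →-dec E? z w

    degB≤ : ∀ z → degB z ≤ sum β
    degB≤ z = sum-mono _ β λ w → ≤-trans (*-monoʳ-≤ (β w) (𝟙≤1 (E? z w))) (≤-reflexive (*-identityʳ _))

    degB< : ∀ z → ¬ Complete z → degB z + 1 ≤ sum β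
    degB< z ¬c with Finₚ.¬∀⟶∃¬ (suc q) _ (λ w → B? w →-dec E? z w) ¬c
    ... | u , ¬BE = begin
      degB z + 1                                      ≡⟨ cong (degB z +_) (sum-𝟙≡-unit u) ⟨
      degB z + ∑[ w < suc q ] 𝟙 (w Fin.≟ u)           ≡⟨ ∑-distrib-+ {suc q} (λ w → β w * ε z w) (λ w → 𝟙 (w Fin.≟ u)) ⟨
      ∑[ w < suc q ] (β w * ε z w + 𝟙 (w Fin.≟ u))    ≤⟨ sum-mono _ β le ⟩
      sum β                                           ∎
      where
      open ≤-Reasoning
      le : ∀ w → β w * ε z w + 𝟙 (w Fin.≟ u) ≤ β w
      le w with w Fin.≟ u
      le w | no _ with B? w
      ... | no _  = ≤-refl
      ... | yes _ with E? z w
      ...   | yes _ = ≤-refl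
      ...   | no _  = z≤n
      le w | yes refl with B? w
      ... | no ¬b = contradiction (λ b → contradiction b ¬b) ¬BE
      ... | yes _ with E? z w
      ...   | yes e = contradiction (λ _ → e) ¬BE
      ...   | no _  = ≤-refl

    -- Every vertex of `A` other than `v` loses at least one of its |B| possible edges; the final 1
    -- returns that loss to the exceptional vertex. Adding `sum α` on the left replaces a
    -- subtraction.
    edges-bound : ∀ v → (∀ z → z ≢ v → A z → ¬ Complete z) →
                  edges + sum α ≤ sum α * sum β + 1
    edges-bound v ¬c = begin
      edges + sum α                                       ≡⟨ ∑-distrib-+ {suc q} (λ z → α z * degB z) α ⟨
      ∑[ z < suc q ] (α z * degB z + α z)                 ≤⟨ sum-mono _ _ le ⟩
      ∑[ z < suc q ] (α z * sum β + 𝟙 (z Fin.≟ v))        ≡⟨ ∑-distrib-+ {suc q} (λ z → α z * sum β) (λ z → 𝟙 (z Fin.≟ v)) ⟩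
      ∑[ z < suc q ] (α z * sum β) + ∑[ z < suc q ] 𝟙 (z Fin.≟ v)
        ≡⟨ cong₂ _+_ (sym (*-distribʳ-sum (sum β) α)) (sum-𝟙≡-unit v) ⟩
      sum α * sum β + 1                                   ∎
      where
      open ≤-Reasoning
      le : ∀ z → α z * degB z + α z ≤ α z * sum β + 𝟙 (z Fin.≟ v)
      le z with A? z
      ... | no _ = z≤n
      ... | yes a with z Fin.≟ v
      ...   | yes _ = +-monoˡ-≤ 1 (*-monoʳ-≤ 1 (degB≤ z))
      ...   | no z≢v = begin
        1 * degB z + 1     ≡⟨ cong (_+ 1) (*-identityˡ _) ⟩
        degB z + 1         ≤⟨ degB< z (¬c z z≢v a) ⟩
        sum β              ≡⟨ trans (+-identityʳ _) (*-identityˡ _) ⟨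
        1 * sum β + 0      ∎

    few : sum α + sum β ≡ suc q → edges + sum α ≤ sum α * sum β + 1 → 2 * (2 * edges) ≤ q * q + 4
    few a+b le = few-edges q (2 * edges) (sum α) (sum β) a+b
      (≤-trans (≤-reflexive (sym (*-distribˡ-+ 2 edges (sum α)))) (*-monoʳ-≤ 2 le))

    two-complete : sum α + sum β ≡ suc q → q * q + 4 < 2 * (2 * edges) →
                   ∃ λ v → ∃ λ v' → v ≢ v' × (A v × Complete v) × (A v' × Complete v')
    two-complete a+b many with Finₚ.any? (λ z → A? z ×-dec complete? z)
    -- With no complete vertex at all, any vertex may serve as the exception in `edges-bound`;
    -- `zero` always exists.
    ... | no none = contradiction
          (few a+b (edges-bound zero λ z _ a c → none (z , a , c))) (<⇒≱ many)
    ... | yes (v , av , cv) with Finₚ.any? (λ z → ¬? (v Fin.≟ z) ×-dec (A? z ×-dec complete? z))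
    ...   | no none = contradiction
            (few a+b (edges-bound v λ z z≢v a c → none (z , (λ e → z≢v (sym e)) , a , c)))
            (<⇒≱ many)
    ...   | yes (v' , v≢v' , av' , cv') = v , v' , v≢v' , (av , cv) , (av' , cv')

  -- The neighbours B of a vertex of maximum degree form an independent set.
  -- If the other vertices A were not independent there would be few edges;
  -- otherwise the graph is bipartite with parts A and B.
  module TriangleFree
    {E : V → V → Set} (E? : ∀ x y → Dec (E x y))
    (E-sym : ∀ {x y} → E x y → E y x)
    (triangle-free : ∀ {x y z} → E x y → E y z → ¬ E x z)
    (many-edges : q * q + 4 < 2 * ∑[ x < suc q ] ∑[ y < suc q ] 𝟙 (E? x y))
    where

    private
      ε : V → V → ℕ
      ε x y = 𝟙 (E? x y)

      deg : V → ℕ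
      deg x = ∑[ y < suc q ] ε x y

      S : ℕ
      S = ∑[ x < suc q ] deg x

    v : V
    v = proj₁ (argmax deg)

    deg≤ : ∀ z → deg z ≤ deg v
    deg≤ = proj₂ (argmax deg)

    A B : V → Set
    A x = ¬ E v x
    B x = E v x

    A? : ∀ x → Dec (A x)
    A? x = ¬? (E? v x)

    B? : ∀ x → Dec (B x)
    B? x = E? v x

    open Bipartite E? A? B? using (α; β; edges) renaming (degB to degᴮ)
    open Bipartite E? B? A? using () renaming (degB to degᴬ; edges to edges')

    a b : ℕ
    a = sum α
    b = sum β

    a+b : a + b ≡ suc q
    a+b = begin
      a + b                          ≡⟨ ∑-distrib-+ {suc q} α β ⟨
      ∑[ x < suc q ] (α x + β x)     ≡⟨ sum-cong-≗ {suc q} (λ x → 𝟙-complement (E? v x)) ⟩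
      ∑[ x < suc q ] 1               ≡⟨ sum-const (suc q) 1 ⟩
      suc q * 1                      ≡⟨ *-identityʳ _ ⟩
      suc q                          ∎
      where open ≡-Reasoning

    ε-sym : ∀ x y → ε x y ≡ ε y x
    ε-sym x y = ≤-antisym (𝟙-mono (E? x y) (E? y x) E-sym) (𝟙-mono (E? y x) (E? x y) E-sym)

    split : ∀ (f : V → ℕ) → ∑[ x < suc q ] (α x * f x) + ∑[ x < suc q ] (β x * f x) ≡ sum f
    split f = trans (sym (∑-distrib-+ {suc q} (λ x → α x * f x) (λ x → β x * f x))) (sum-cong-≗ {suc q} λ x → begin
      α x * f x + β x * f x ≡⟨ *-distribʳ-+ (f x) (α x) (β x) ⟨
      (α x + β x) * f x     ≡⟨ cong (_* f x) (𝟙-complement (E? v x)) ⟩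
      1 * f x               ≡⟨ *-identityˡ _ ⟩
      f x                   ∎)
      where open ≡-Reasoning

    deg-split : ∀ x → degᴬ x + degᴮ x ≡ deg x
    deg-split x = split (ε x)

    -- Two adjacent neighbours of `v` would form a triangle with it.
    degᴮ-B : ∀ x → B x → degᴮ x ≡ 0
    degᴮ-B x Bx = sum-zero _ λ w → term w
      where
      term : ∀ w → β w * ε x w ≡ 0
      term w with E? v w
      ... | no _ = refl
      ... | yes Bw = trans (+-identityʳ _) (𝟙-no (E? x w) (λ e → triangle-free Bx e Bw))

    exchange : ∀ (f g : V → ℕ) →
      ∑[ x < suc q ] (f x * ∑[ y < suc q ] (g y * ε x y)) ≡
      ∑[ y < suc q ] (g y * ∑[ x < suc q ] (f x * ε y x))
    exchange f g = begin
      ∑[ x < suc q ] (f x * ∑[ y < suc q ] (g y * ε x y))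
        ≡⟨ sum-cong-≗ {suc q} (λ x → *-distribˡ-sum (f x) (λ y → g y * ε x y)) ⟩
      ∑[ x < suc q ] ∑[ y < suc q ] (f x * (g y * ε x y))
        ≡⟨ ∑-comm {suc q} {suc q} (λ x y → f x * (g y * ε x y)) ⟩
      ∑[ y < suc q ] ∑[ x < suc q ] (f x * (g y * ε x y))
        ≡⟨ sum-cong-≗ {suc q} (λ y → sum-cong-≗ {suc q} (λ x → eq (f x) (g y) (ε-sym x y))) ⟩
      ∑[ y < suc q ] ∑[ x < suc q ] (g y * (f x * ε y x))
        ≡⟨ sum-cong-≗ {suc q} (λ y → *-distribˡ-sum (g y) (λ x → f x * ε y x)) ⟨
      ∑[ y < suc q ] (g y * ∑[ x < suc q ] (f x * ε y x)) ∎
      where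
      open ≡-Reasoning
      eq : ∀ s t {e e'} → e ≡ e' → s * (t * e) ≡ t * (s * e')
      eq s t refl = x∙yz≈y∙xz s t _

    edges≡edges' : edges ≡ edges'
    edges≡edges' = exchange α β

    -- By `degᴮ-B` all neighbours of a vertex of `B` lie in `A`, so the degrees in `B` count each
    -- edge between the parts exactly once.
    ∑B-deg : ∑[ x < suc q ] (β x * deg x) ≡ edges
    ∑B-deg = trans (sum-cong-≗ {suc q} term) (sym edges≡edges')
      where
      term : ∀ x → β x * deg x ≡ β x * degᴬ x
      term x with E? v x
      ... | no _ = refl
      ... | yes Bx = cong (1 *_) (trans (sym (deg-split x)) (trans (cong (degᴬ x +_) (degᴮ-B x Bx)) (+-identityʳ _)))

    S≡ : S ≡ ∑[ x < suc q ] (α x * deg x) + edges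
    S≡ = trans (sym (split deg)) (cong (∑[ x < suc q ] (α x * deg x) +_) ∑B-deg)

    term-degᴬ : ∀ x y → A y → E x y → 1 ≤ degᴬ x
    term-degᴬ x y Ay e = ≤-trans (≤-reflexive (sym one)) (term≤sum (λ w → α w * ε x w) y)
      where
      one : α y * ε x y ≡ 1
      one = cong₂ _*_ (𝟙-yes (A? y) Ay) (𝟙-yes (E? x y) e)

    α-one : ∀ {x} → A x → α x ≡ 1
    α-one {x} = 𝟙-yes (A? x)

    module _ {x y : V} (Ax : A x) (Ay : A y) (Exy : E x y) where

      private
        -- Summed over `A`, the first two terms give the degree sum `S` and the last two give
        -- `degᴬ x + degᴬ y`. That surplus cancels against the same quantity in `load x + load y`,
        -- where `ends` leaves only 2b + 2 in place of the general bound 4b.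
        load : V → ℕ
        load z = deg z + degᴮ z + (ε z x + ε z y)

        c : ℕ
        c = 2 * b

      x≢y : x ≢ y
      x≢y refl = triangle-free Exy Exy Exy

      -- No vertex is adjacent to both `x` and `y`, and adjacency to one of them is already counted
      -- in `degᴬ z`. So the load is at most 2 deg z, and deg z ≤ deg v = b by the choice of `v`.
      load≤ : ∀ z → A z → load z ≤ c
      load≤ z Az = begin
        deg z + degᴮ z + (ε z x + ε z y)   ≡⟨ +-assoc (deg z) _ _ ⟩
        deg z + (degᴮ z + (ε z x + ε z y)) ≤⟨ +-monoʳ-≤ (deg z) (+-monoʳ-≤ (degᴮ z) pair) ⟩
        deg z + (degᴮ z + degᴬ z)          ≡⟨ cong (deg z +_) (trans (+-comm (degᴮ z) _) (deg-split z)) ⟩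
        deg z + deg z                      ≤⟨ +-mono-≤ (deg≤ z) (deg≤ z) ⟩
        b + b                              ≡⟨ cong (b +_) (+-identityʳ b) ⟨
        c                                  ∎
        where
        open ≤-Reasoning
        pair : ε z x + ε z y ≤ degᴬ z
        pair with E? z x | E? z y
        ... | yes e | yes e' = contradiction e' (triangle-free e Exy)
        ... | yes e | no _   = term-degᴬ z x Ax e
        ... | no _  | yes e  = term-degᴬ z y Ay e
        ... | no _  | no _   = z≤n

      Σload : ∑[ z < suc q ] (α z * load z) ≡ S + (degᴬ x + degᴬ y)
      Σload = begin
        ∑[ z < suc q ] (α z * load z)
          ≡⟨ sum-cong-≗ {suc q} (λ z → distrib (α z) (deg z) (degᴮ z) (ε-sym z x) (ε-sym z y)) ⟩
        ∑[ z < suc q ] ((α z * deg z + α z * degᴮ z) + (α z * ε x z + α z * ε y z))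
          ≡⟨ ∑-distrib-+ {suc q} (λ z → α z * deg z + α z * degᴮ z) (λ z → α z * ε x z + α z * ε y z) ⟩
        ∑[ z < suc q ] (α z * deg z + α z * degᴮ z) + ∑[ z < suc q ] (α z * ε x z + α z * ε y z)
          ≡⟨ cong₂ _+_ (∑-distrib-+ {suc q} (λ z → α z * deg z) (λ z → α z * degᴮ z))
                       (∑-distrib-+ {suc q} (λ z → α z * ε x z) (λ z → α z * ε y z)) ⟩
        (∑[ z < suc q ] (α z * deg z) + edges) + (degᴬ x + degᴬ y)
          ≡⟨ cong (_+ (degᴬ x + degᴬ y)) S≡ ⟨
        S + (degᴬ x + degᴬ y) ∎
        where
        open ≡-Reasoning
        distrib : ∀ s t u {e e' f f'} → e ≡ e' → f ≡ f' →
                  s * (t + u + (e + f)) ≡ (s * t + s * u) + (s * e' + s * f')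
        distrib s t u {e} {_} {f} refl refl = go s t u e f
          where
          go : ∀ s t u e f → s * (t + u + (e + f)) ≡ (s * t + s * u) + (s * e + s * f)
          go = solve-∀

      -- Only `x` and `y` keep their true loads; at every other vertex of `A` the bound `c` is used.
      -- The terms `c` on the left stand for a subtraction on the right.
      load-bound : ∀ z → α z * load z + (𝟙 (z Fin.≟ x) * c + 𝟙 (z Fin.≟ y) * c) ≤
                         α z * c + (𝟙 (z Fin.≟ x) * load x + 𝟙 (z Fin.≟ y) * load y)
      load-bound z with z Fin.≟ x | z Fin.≟ y
      ... | yes refl | yes refl = contradiction refl x≢y
      ... | yes refl | no _ = ≤-reflexive (trans (cong (λ s → s * load x + (1 * c + 0)) (α-one Ax))
              (trans (eq (load x) c) (cong (λ s → s * c + (1 * load x + 0)) (sym (α-one Ax)))))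
        where
        eq : ∀ l c → 1 * l + (1 * c + 0) ≡ 1 * c + (1 * l + 0)
        eq = solve-∀
      ... | no _ | yes refl = ≤-reflexive (trans (cong (λ s → s * load y + (0 + 1 * c)) (α-one Ay))
              (trans (eq (load y) c) (cong (λ s → s * c + (0 + 1 * load y)) (sym (α-one Ay)))))
        where
        eq : ∀ l c → 1 * l + (0 + 1 * c) ≡ 1 * c + (0 + 1 * l)
        eq = solve-∀
      ... | no _ | no _ = +-monoˡ-≤ 0 (le (A? z))
        where
        le : (d : Dec (A z)) → 𝟙 d * load z ≤ 𝟙 d * c
        le (yes Az) = *-monoʳ-≤ 1 (load≤ z Az)
        le (no _)   = z≤n

      total-bound : (S + (degᴬ x + degᴬ y)) + (c + c) ≤ a * c + (load x + load y)
      total-bound = begin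
        (S + (degᴬ x + degᴬ y)) + (c + c)
          ≡⟨ cong₂ _+_ Σload (trans (∑-distrib-+ {suc q} (at x c) (at y c)) (cong₂ _+_ (sum-𝟙≡ x c) (sum-𝟙≡ y c))) ⟨
        ∑[ z < suc q ] (α z * load z) + ∑[ z < suc q ] (𝟙 (z Fin.≟ x) * c + 𝟙 (z Fin.≟ y) * c)
          ≡⟨ ∑-distrib-+ {suc q} (λ z → α z * load z) (λ z → at x c z + at y c z) ⟨
        ∑[ z < suc q ] (α z * load z + (𝟙 (z Fin.≟ x) * c + 𝟙 (z Fin.≟ y) * c))
          ≤⟨ sum-mono _ _ load-bound ⟩
        ∑[ z < suc q ] (α z * c + (𝟙 (z Fin.≟ x) * load x + 𝟙 (z Fin.≟ y) * load y))
          ≡⟨ ∑-distrib-+ {suc q} (λ z → α z * c) (λ z → at x (load x) z + at y (load y) z) ⟩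
        ∑[ z < suc q ] (α z * c) + ∑[ z < suc q ] (𝟙 (z Fin.≟ x) * load x + 𝟙 (z Fin.≟ y) * load y)
          ≡⟨ cong₂ _+_ (sym (*-distribʳ-sum c α))
               (trans (∑-distrib-+ {suc q} (at x (load x)) (at y (load y))) (cong₂ _+_ (sum-𝟙≡ x (load x)) (sum-𝟙≡ y (load y)))) ⟩
        a * c + (load x + load y) ∎
        where
        open ≤-Reasoning
        at : V → ℕ → V → ℕ
        at u k z = 𝟙 (z Fin.≟ u) * k

      -- The ends of an edge have no common neighbour, so their neighbourhoods in `B` are disjoint.
      ends : degᴮ x + degᴮ y ≤ b
      ends = begin
        degᴮ x + degᴮ y                                ≡⟨ ∑-distrib-+ {suc q} (λ w → β w * ε x w) (λ w → β w * ε y w) ⟨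
        ∑[ w < suc q ] (β w * ε x w + β w * ε y w)     ≤⟨ sum-mono _ β le ⟩
        b                                              ∎
        where
        open ≤-Reasoning
        le : ∀ w → β w * ε x w + β w * ε y w ≤ β w
        le w with E? v w | E? x w | E? y w
        ... | no _  | _     | _     = z≤n
        ... | yes _ | yes e | yes f = contradiction e (triangle-free Exy f)
        ... | yes _ | yes _ | no _  = ≤-refl
        ... | yes _ | no _  | yes _ = ≤-refl
        ... | yes _ | no _  | no _  = z≤n

      load-x : load x ≡ degᴬ x + 2 * degᴮ x + 1
      load-x = trans
        (cong₂ (λ d e → d + degᴮ x + e) (sym (deg-split x))
          (cong₂ _+_ (𝟙-no (E? x x) (λ e → triangle-free e e e)) (𝟙-yes (E? x y) Exy)))
        (eq (degᴬ x) (degᴮ x))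
        where
        eq : ∀ s t → s + t + t + 1 ≡ s + 2 * t + 1
        eq = solve-∀

      load-y : load y ≡ degᴬ y + 2 * degᴮ y + 1
      load-y = trans
        (cong₂ (λ d e → d + degᴮ y + e) (sym (deg-split y))
          (cong₂ _+_ (𝟙-yes (E? y x) (E-sym Exy)) (𝟙-no (E? y y) (λ e → triangle-free e e e))))
        (eq (degᴬ y) (degᴮ y))
        where
        eq : ∀ s t → s + t + t + 1 ≡ s + 2 * t + 1
        eq = solve-∀

      few-edges-in-all : S + 2 * b ≤ 2 * (b * a + 1)
      few-edges-in-all = +-cancelˡ-≤ (c + (degᴬ x + degᴬ y)) _ _ (begin
        c + (degᴬ x + degᴬ y) + (S + c)           ≡⟨ eq₁ c (degᴬ x + degᴬ y) S ⟩
        (S + (degᴬ x + degᴬ y)) + (c + c)         ≤⟨ total-bound ⟩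
        a * c + (load x + load y)                 ≡⟨ cong (a * c +_) (cong₂ _+_ load-x load-y) ⟩
        a * c + ((degᴬ x + 2 * degᴮ x + 1) + (degᴬ y + 2 * degᴮ y + 1))
          ≡⟨ eq₂ a c (degᴬ x) (degᴬ y) (degᴮ x) (degᴮ y) ⟩
        (a * c + (degᴬ x + degᴬ y) + 2) + 2 * (degᴮ x + degᴮ y)
          ≤⟨ +-monoʳ-≤ (a * c + (degᴬ x + degᴬ y) + 2) (*-monoʳ-≤ 2 ends) ⟩
        (a * c + (degᴬ x + degᴬ y) + 2) + c       ≡⟨ eq₃ a b (degᴬ x + degᴬ y) ⟩
        c + (degᴬ x + degᴬ y) + 2 * (b * a + 1)   ∎)
        where
        open ≤-Reasoning
        eq₁ : ∀ c d s → c + d + (s + c) ≡ (s + d) + (c + c)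
        eq₁ = solve-∀
        eq₂ : ∀ a c s t u w → a * c + ((s + 2 * u + 1) + (t + 2 * w + 1)) ≡
                              (a * c + (s + t) + 2) + 2 * (u + w)
        eq₂ = solve-∀
        eq₃ : ∀ a b d → (a * (2 * b) + d + 2) + 2 * b ≡ 2 * b + d + 2 * (b * a + 1)
        eq₃ = solve-∀

    A-independent : ∀ {x y} → A x → A y → ¬ E x y
    -- The sizes change places here: an edge inside `A` bounds the edges by b (a - 1) + 1.
    A-independent Ax Ay Exy = <⇒≱ many-edges
      (few-edges q S b a (trans (+-comm b a) a+b) (few-edges-in-all Ax Ay Exy))

    S≡2edges : S ≡ 2 * edges
    S≡2edges = trans S≡ (trans (cong (_+ edges) (sum-cong-≗ {suc q} term)) (cong (edges +_) (sym (+-identityʳ edges))))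
      where
      degᴬ-A : ∀ x → A x → degᴬ x ≡ 0
      degᴬ-A x Ax = sum-zero _ λ w → term w
        where
        term : ∀ w → α w * ε x w ≡ 0
        term w with E? v w
        ... | yes _ = refl
        ... | no Aw = trans (+-identityʳ _) (𝟙-no (E? x w) (A-independent Ax Aw))
      term : ∀ x → α x * deg x ≡ α x * degᴮ x
      term x with E? v x
      ... | yes _ = refl
      ... | no Ax = cong (1 *_) (trans (sym (deg-split x)) (cong (_+ degᴮ x) (degᴬ-A x Ax)))

    bipartition :
      (∃ λ v → ∃ λ v' → v ≢ v' × (A v × (∀ w → B w → E v w)) × (A v' × (∀ w → B w → E v' w))) ×
      (∃ λ w → ∃ λ w' → w ≢ w' × (B w × (∀ v → A v → E w v)) × (B w' × (∀ v → A v → E w' v)))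
    bipartition =
      Bipartite.two-complete E? A? B? a+b (subst (λ s → q * q + 4 < 2 * s) S≡2edges many-edges) ,
      Bipartite.two-complete E? B? A? (trans (+-comm b a) a+b)
        (subst (λ s → q * q + 4 < 2 * s) (trans S≡2edges (cong (2 *_) edges≡edges')) many-edges)

-- From few covered points to two families of meeting lines.

record MeetingParts {V Pt : Set} (On : Pt → V → Set) : Set₁ where
  Meet : V → V → Set
  Meet x y = ∃ λ p → On p x × On p y
  field
    A B         : V → Set
    either      : ∀ x → A x ⊎ B x
    exclusive   : ∀ x → A x → ¬ B x
    {a a' b b'} : V
    a≢a'        : a ≢ a'
    b≢b'        : b ≢ b'
    a∈A         : A a
    a'∈A        : A a'
    b∈B         : B b
    b'∈B        : B b'
    a-meets     : ∀ x → B x → Meet a x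
    a'-meets    : ∀ x → B x → Meet a' x
    b-meets     : ∀ x → A x → Meet b x
    b'-meets    : ∀ x → A x → Meet b' x
    no-common-point : ∀ {p} → On p a → On p a' → On p b → On p b' → ⊥

-- Points will be coordinate functions, which are compared only pointwise. That two distinct lines
-- share a single point is therefore expressed by `transfer`: any two common points lie on the same
-- lines.
module FewPoints
  (q N : ℕ) {Pt : Set} (On : Pt → Fin (suc q) → Set) (On? : ∀ p i → Dec (On p i))
  (pt : Fin (suc q) → Fin q → Pt) (pt-on : ∀ i t → On (pt i t) i)
  (pt-unique : ∀ {i j t t'} → i ≢ j → On (pt i t) j → On (pt i t') j → t ≡ t')
  (transfer : ∀ {i j k p p'} → i ≢ j → On p i → On p j → On p' i → On p' j → On p k → On p' k)
  (concurrent : ∀ {i j k p r u} → i ≢ j → j ≢ k → i ≢ k →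
     On p i → On p j → On r j → On r k → On u i → On u k → On p k)
  (index : Fin (suc q) → Fin q → Fin N)
  (index-on : ∀ {i j t t'} → index i t ≡ index j t' → On (pt i t) j)
  (index-injective : ∀ {i t t'} → index i t ≡ index i t' → t ≡ t')
  where
  open Counting
  open import Data.Nat using (_+_; _*_; _≤_; _<_)
  open ℕₚ

  private
    V : Set
    V = Fin (suc q)

  First : Pt → V → Set
  First p i = On p i × (∀ j → j Fin.< i → ¬ On p j)

  First? : ∀ p i → Dec (First p i)
  First? p i = On? p i ×-dec Finₚ.all? (λ j → (j Finₚ.<? i) →-dec ¬? (On? p j))

  first-unique : ∀ {p i j} → First p i → First p j → i ≡ j
  first-unique {p} {i} {j} (oi , mi) (oj , mj) with Finₚ.<-cmp i j
  ... | tri< lt _ _ = contradiction oi (mj i lt)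
  ... | tri≈ _ eq _ = eq
  ... | tri> _ _ gt = contradiction oj (mi j gt)

  first-exists : ∀ {p i} → On p i → ∃ λ j → First p j
  first-exists {p} {i} o
    with Finₚ.¬∀⟶∃¬-smallest (suc q) (λ k → ¬ On p k) (λ k → ¬? (On? p k)) (λ f → f i o)
  ... | j , ¬¬o , below = j , decidable-stable (On? p j) ¬¬o , λ k k<j →
        subst (λ l → ¬ On p l)
          (Finₚ.toℕ-injective (trans (Finₚ.toℕ-inject (Fin.fromℕ< k<j)) (Finₚ.toℕ-fromℕ< k<j)))
          (below (Fin.fromℕ< k<j))

  -- Each point of the union is charged to the first line through it, and each
  -- further line through it to an edge joining that line to the first one.
  Charge : V → V → Fin q → Set
  Charge j i t = j Fin.< i × First (pt i t) j

  Charge? : ∀ j i t → Dec (Charge j i t)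
  Charge? j i t = (j Finₚ.<? i) ×-dec First? (pt i t) j

  Arc : V → V → Set
  Arc j i = ∃ λ t → Charge j i t

  Arc? : ∀ j i → Dec (Arc j i)
  Arc? j i = Finₚ.any? (Charge? j i)

  arcs : ℕ
  arcs = ∑[ j < suc q ] ∑[ i < suc q ] 𝟙 (Arc? j i)

  charge : ∀ i t → 1 ≤ 𝟙 (First? (pt i t) i) + ∑[ j < suc q ] 𝟙 (Charge? j i t)
  charge i t with first-exists (pt-on i t)
  ... | j , fj with Finₚ.<-cmp j i
  ...   | tri< j<i _ _ = ≤-trans
          (≤-trans (≤-reflexive (sym (𝟙-yes (Charge? j i t) (j<i , fj))))
                   (term≤sum (λ k → 𝟙 (Charge? k i t)) j))
          (m≤n+m _ (𝟙 (First? (pt i t) i)))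
  ...   | tri≈ _ refl _ = ≤-trans (≤-reflexive (sym (𝟙-yes (First? (pt i t) i) fj))) (m≤m+n _ _)
  ...   | tri> _ _ i<j = contradiction (pt-on i t) (proj₂ fj i i<j)

  -- Sorting by position in the list, each position is used at most once: equal positions mean the
  -- same point, its first line is unique, and that line passes through it for only one value of
  -- `t`.
  firsts≤N : ∑[ i < suc q ] ∑[ t < q ] 𝟙 (First? (pt i t) i) ≤ N
  firsts≤N = begin
    ∑[ i < suc q ] ∑[ t < q ] 𝟙 (First? (pt i t) i)
      ≤⟨ sum-mono {suc q} _ _ (λ i → sum-mono {q} _ _ (λ t → le i t)) ⟩
    ∑[ i < suc q ] ∑[ t < q ] ∑[ p < N ] 𝟙 (at? i t p)
      ≡⟨ sum-cong-≗ {suc q} (λ i → ∑-comm {q} {N} (λ t p → 𝟙 (at? i t p))) ⟩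
    ∑[ i < suc q ] ∑[ p < N ] ∑[ t < q ] 𝟙 (at? i t p)
      ≡⟨ ∑-comm {suc q} {N} (λ i p → ∑[ t < q ] 𝟙 (at? i t p)) ⟩
    ∑[ p < N ] ∑[ i < suc q ] ∑[ t < q ] 𝟙 (at? i t p)
      ≤⟨ sum-mono {N} _ _ (λ p → ∑∑≤1 (λ i t → at? i t p) unique) ⟩
    ∑[ p < N ] 1
      ≡⟨ trans (sum-const N 1) (*-identityʳ N) ⟩
    N ∎
    where
    open ≤-Reasoning
    at? : ∀ i t p → Dec (First (pt i t) i × index i t ≡ p)
    at? i t p = First? (pt i t) i ×-dec (index i t Fin.≟ p)
    le : ∀ i t → 𝟙 (First? (pt i t) i) ≤ ∑[ p < N ] 𝟙 (at? i t p)
    le i t = ≤-trans (𝟙-mono (First? (pt i t) i) (at? i t (index i t)) (λ f → f , refl))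
                     (term≤sum (λ p → 𝟙 (at? i t p)) (index i t))
    unique : ∀ {p i t i' t'} → First (pt i t) i × index i t ≡ p →
             First (pt i' t') i' × index i' t' ≡ p → i ≡ i' × t ≡ t'
    unique {p} {i} {t} {i'} {t'} (f , e) (f' , e') with Finₚ.<-cmp i i'
    ... | tri< lt _ _ = contradiction (index-on (trans e' (sym e))) (proj₂ f' i lt)
    ... | tri≈ _ refl _ = refl , index-injective (trans e (sym e'))
    ... | tri> _ _ gt = contradiction (index-on (trans e (sym e'))) (proj₂ f i' gt)

  -- Two charges along the same arc would give distinct lines two common points.
  charges≤arc : ∀ j i → ∑[ t < q ] 𝟙 (Charge? j i t) ≤ 𝟙 (Arc? j i)
  charges≤arc j i with Arc? j i
  ... | no ¬arc = ≤-reflexive (sum-zero {q} _ (λ t → 𝟙-no (Charge? j i t) (λ c → ¬arc (t , c))))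
  ... | yes _ = sum≤1 {q} _ (λ t → 𝟙≤1 (Charge? j i t)) λ t t' x y →
        let (j<i , f) = 𝟙≢0 (Charge? j i t) x ; (_ , f') = 𝟙≢0 (Charge? j i t') y
        in pt-unique (λ i≡j → Finₚ.<-irrefl (sym i≡j) j<i) (proj₁ f) (proj₁ f')

  -- Double counting of the q (q + 1) incidences: one on the first line through its point is paid
  -- for by that point, any other by an arc.
  points-arcs : suc q * q ≤ N + arcs
  points-arcs = begin
    suc q * q
      ≡⟨ trans (sum-cong-≗ {suc q} (λ i → trans (sum-const q 1) (*-identityʳ q))) (sum-const (suc q) q) ⟨
    ∑[ i < suc q ] ∑[ t < q ] 1
      ≤⟨ sum-mono {suc q} _ _ (λ i → sum-mono {q} _ _ (charge i)) ⟩
    ∑[ i < suc q ] ∑[ t < q ] (f i t + ∑[ j < suc q ] g j i t)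
      ≡⟨ sum-cong-≗ {suc q} (λ i → ∑-distrib-+ {q} (f i) (λ t → ∑[ j < suc q ] g j i t)) ⟩
    ∑[ i < suc q ] (∑[ t < q ] f i t + ∑[ t < q ] ∑[ j < suc q ] g j i t)
      ≡⟨ ∑-distrib-+ {suc q} (λ i → ∑[ t < q ] f i t) (λ i → ∑[ t < q ] ∑[ j < suc q ] g j i t) ⟩
    ∑[ i < suc q ] ∑[ t < q ] f i t + ∑[ i < suc q ] ∑[ t < q ] ∑[ j < suc q ] g j i t
      ≡⟨ cong (∑[ i < suc q ] ∑[ t < q ] f i t +_) (trans
           (sum-cong-≗ {suc q} (λ i → ∑-comm {q} {suc q} (λ t j → g j i t)))
           (∑-comm {suc q} {suc q} (λ i j → ∑[ t < q ] g j i t))) ⟩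
    ∑[ i < suc q ] ∑[ t < q ] f i t + ∑[ j < suc q ] ∑[ i < suc q ] ∑[ t < q ] g j i t
      ≤⟨ +-mono-≤ firsts≤N (sum-mono {suc q} _ _ (λ j → sum-mono {suc q} _ _ (charges≤arc j))) ⟩
    N + arcs ∎
    where
    open ≤-Reasoning
    f : V → Fin q → ℕ
    f i t = 𝟙 (First? (pt i t) i)
    g : V → V → Fin q → ℕ
    g j i t = 𝟙 (Charge? j i t)

  E : V → V → Set
  E x y = Arc x y ⊎ Arc y x

  E? : ∀ x y → Dec (E x y)
  E? x y = Arc? x y ⊎-dec Arc? y x

  E-sym : ∀ {x y} → E x y → E y x
  E-sym (inj₁ e) = inj₂ e
  E-sym (inj₂ e) = inj₁ e

  E-irrefl : ∀ {x y} → E x y → x ≢ y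
  E-irrefl (inj₁ (_ , lt , _)) refl = <-irrefl refl lt
  E-irrefl (inj₂ (_ , lt , _)) refl = <-irrefl refl lt

  meet : ∀ {x y} → E x y → ∃ λ p → (First p x ⊎ First p y) × On p x × On p y
  meet {x} {y} (inj₁ (t , _ , f)) = pt y t , inj₁ f , proj₁ f , pt-on y t
  meet {x} {y} (inj₂ (t , _ , f)) = pt x t , inj₂ f , pt-on x t , proj₁ f

  -- The point that witnesses the edge and `p` are both common to two distinct lines. By `transfer`
  -- in both directions they lie on the same lines, so they have the same first line.
  first-at : ∀ {x y p} → E x y → On p x → On p y → First p x ⊎ First p y
  first-at {x} {y} {p} e px py with meet e
  ... | p' , f , p'x , p'y = move f
    where
    up : ∀ {k} → On p' k → On p k
    up = transfer (E-irrefl e) p'x p'y px py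
    down : ∀ {k} → On p k → On p' k
    down = transfer (E-irrefl e) px py p'x p'y
    move : First p' x ⊎ First p' y → First p x ⊎ First p y
    move (inj₁ (o , m)) = inj₁ (up o , λ j lt o' → m j lt (down o'))
    move (inj₂ (o , m)) = inj₂ (up o , λ j lt o' → m j lt (down o'))

  -- The three lines would share a point, and each of the three edges would have the unique first
  -- line through it as an end. No vertex is an end of all three edges of a triangle.
  triangle-free : ∀ {x y z} → E x y → E y z → ¬ E x z
  triangle-free {x} {y} {z} exy eyz exz = clash (first-at exy px py)
    where
    x≢y = E-irrefl exy
    y≢z = E-irrefl eyz
    x≢z = E-irrefl exz
    p = proj₁ (meet exy)
    px = proj₁ (proj₂ (proj₂ (meet exy)))
    py = proj₂ (proj₂ (proj₂ (meet exy)))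
    pz : On p z
    pz with meet eyz | meet exz
    ... | _ , _ , ry , rz | _ , _ , ux , uz = concurrent x≢y y≢z x≢z px py ry rz ux uz
    clash : First p x ⊎ First p y → ⊥
    clash (inj₁ fx) with first-at eyz py pz
    ... | inj₁ fy = x≢y (first-unique fx fy)
    ... | inj₂ fz = x≢z (first-unique fx fz)
    clash (inj₂ fy) with first-at exz px pz
    ... | inj₁ fx = x≢y (first-unique fx fy)
    ... | inj₂ fz = y≢z (first-unique fy fz)

  -- At a common point the unique first line would be an end of both `v w` and `v' w'`, but these
  -- edges have no end in common.
  no-common-point : ∀ {v v' w w' p} → v ≢ v' → w ≢ w' →
    E v w → E v w' → E v' w → E v' w' → On p v → On p v' → On p w → On p w' → ⊥
  no-common-point v≢v' w≢w' vw vw' v'w v'w' pv pv' pw pw' with first-at vw pv pw | first-at v'w' pv' pw'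
  ... | inj₁ f | inj₁ g = v≢v' (first-unique f g)
  ... | inj₁ f | inj₂ g = E-irrefl vw' (first-unique f g)
  ... | inj₂ f | inj₁ g = E-irrefl v'w (first-unique g f)
  ... | inj₂ f | inj₂ g = w≢w' (first-unique f g)

  degree-sum : ∑[ x < suc q ] ∑[ y < suc q ] 𝟙 (E? x y) ≡ arcs + arcs
  degree-sum = begin
    ∑[ x < suc q ] ∑[ y < suc q ] 𝟙 (E? x y)
      ≡⟨ sum-cong-≗ {suc q} (λ x → sum-cong-≗ {suc q} (term x)) ⟩
    ∑[ x < suc q ] ∑[ y < suc q ] (a x y + a y x)
      ≡⟨ sum-cong-≗ {suc q} (λ x → ∑-distrib-+ {suc q} (a x) (λ y → a y x)) ⟩
    ∑[ x < suc q ] (∑[ y < suc q ] a x y + ∑[ y < suc q ] a y x)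
      ≡⟨ ∑-distrib-+ {suc q} (λ x → ∑[ y < suc q ] a x y) (λ x → ∑[ y < suc q ] a y x) ⟩
    arcs + ∑[ x < suc q ] ∑[ y < suc q ] a y x
      ≡⟨ cong (arcs +_) (∑-comm {suc q} {suc q} (λ x y → a y x)) ⟩
    arcs + arcs ∎
    where
    open ≡-Reasoning
    a : V → V → ℕ
    a x y = 𝟙 (Arc? x y)
    term : ∀ x y → 𝟙 (E? x y) ≡ a x y + a y x
    term x y with Arc? x y | Arc? y x
    -- An arc runs from the smaller index to the larger, so no pair is joined by arcs in both
    -- directions.
    ... | yes (_ , lt , _) | yes (_ , gt , _) = contradiction gt (<-asym lt)
    ... | yes _ | no _  = refl
    ... | no _  | yes _ = refl
    ... | no _  | no _  = refl

  module _ (few : 4 * N + 4 < 3 * q * q + 4 * q) where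

    many-edges : q * q + 4 < 2 * ∑[ x < suc q ] ∑[ y < suc q ] 𝟙 (E? x y)
    many-edges = subst (λ s → q * q + 4 < 2 * s) (sym degree-sum)
      -- Adding 3q² + 4q turns q² + 4 into 4q (q + 1) + 4, which `points-arcs` bounds; the
      -- hypothesis on `N` then restores 3q² + 4q on the other side.
      (+-cancelˡ-< (3 * q * q + 4 * q) _ _ (begin-strict
        3 * q * q + 4 * q + (q * q + 4)         ≡⟨ eq₁ q ⟩
        4 * (suc q * q) + 4                     ≤⟨ +-monoˡ-≤ 4 (*-monoʳ-≤ 4 points-arcs) ⟩
        4 * (N + arcs) + 4                      ≡⟨ eq₂ N arcs ⟩
        (4 * N + 4) + 2 * (arcs + arcs)         <⟨ +-monoˡ-< (2 * (arcs + arcs)) few ⟩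
        3 * q * q + 4 * q + 2 * (arcs + arcs)   ∎))
      where
      open ≤-Reasoning
      eq₁ : ∀ q → 3 * q * q + 4 * q + (q * q + 4) ≡ 4 * (suc q * q) + 4
      eq₁ = solve-∀
      eq₂ : ∀ n e → 4 * (n + e) + 4 ≡ (4 * n + 4) + 2 * (e + e)
      eq₂ = solve-∀

    open DenseGraph q using (module TriangleFree)
    open TriangleFree {E} E? E-sym triangle-free many-edges using (A; B; B?; bipartition)

    meetingParts : MeetingParts On
    meetingParts = record
      { A = A ; B = B
      ; either = λ x → [ inj₂ , inj₁ ]′ (toSum (B? x)) ; exclusive = λ _ ¬b b → ¬b b
      ; a≢a' = v≢v' ; b≢b' = w≢w' ; a∈A = Av ; a'∈A = Av' ; b∈B = Bw ; b'∈B = Bw'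
      ; a-meets = λ x Bx → points (cv x Bx) ; a'-meets = λ x Bx → points (cv' x Bx)
      ; b-meets = λ x Ax → points (cw x Ax) ; b'-meets = λ x Ax → points (cw' x Ax)
      ; no-common-point = no-common-point v≢v' w≢w' (cv _ Bw) (cv _ Bw') (cv' _ Bw) (cv' _ Bw')
      }
      where
      points : ∀ {x y} → E x y → ∃ λ p → On p x × On p y
      points e = proj₁ (meet e) , proj₂ (proj₂ (meet e))
      v-side = proj₁ bipartition
      w-side = proj₂ bipartition
      v≢v' = proj₁ (proj₂ (proj₂ v-side))
      w≢w' = proj₁ (proj₂ (proj₂ w-side))
      Av  = proj₁ (proj₁ (proj₂ (proj₂ (proj₂ v-side))))
      cv  = proj₂ (proj₁ (proj₂ (proj₂ (proj₂ v-side))))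
      Av' = proj₁ (proj₂ (proj₂ (proj₂ (proj₂ v-side))))
      cv' = proj₂ (proj₂ (proj₂ (proj₂ (proj₂ v-side))))
      Bw  = proj₁ (proj₁ (proj₂ (proj₂ (proj₂ w-side))))
      cw  = proj₂ (proj₁ (proj₂ (proj₂ (proj₂ w-side))))
      Bw' = proj₁ (proj₂ (proj₂ (proj₂ (proj₂ w-side))))
      cw' = proj₂ (proj₂ (proj₂ (proj₂ (proj₂ w-side))))

-- Finite fields of even order.

module CharacteristicTwo {q : ℕ} (𝔽 : FiniteField q) (h : ℕ) (q≡ : q ≡ 2 ^ suc h) where
  open FiniteField 𝔽
  open Inverse enumeration using (to; from; strictlyInverseˡ; strictlyInverseʳ)

  commutativeRing : CommutativeRing 0ℓ 0ℓ
  commutativeRing = record { isCommutativeRing = isCommutativeRing }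

  open CommutativeRing commutativeRing
    using (+-assoc; +-identityˡ; +-identityʳ; *-assoc; *-comm; *-identityˡ;
           zeroˡ; zeroʳ; -‿inverseˡ; -‿inverseʳ; +-commutativeMonoid; semiring; +-group)
  open import Algebra.Properties.Group +-group using (∙-cancelˡ)

  infix 4 _≟_
  _≟_ : (x y : Carrier) → Dec (x ≡ y)
  x ≟ y = map′ (λ eq → trans (sym (strictlyInverseˡ x)) (trans (cong to eq) (strictlyInverseˡ y)))
               (cong from) (from x Fin.≟ from y)

  no-zero-divisors : ∀ {x y} → x * y ≡ 0# → x ≢ 0# → y ≡ 0#
  no-zero-divisors {x} {y} xy x≢0 with inverse x x≢0
  ... | i , xi = begin
    y             ≡⟨ *-identityˡ y ⟨
    1# * y        ≡⟨ cong (_* y) (trans (sym xi) (*-comm x i)) ⟩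
    i * x * y     ≡⟨ *-assoc i x y ⟩
    i * (x * y)   ≡⟨ cong (i *_) xy ⟩
    i * 0#        ≡⟨ zeroʳ i ⟩
    0#            ∎
    where open ≡-Reasoning

  *-nonzero : ∀ {x y} → x ≢ 0# → y ≢ 0# → x * y ≢ 0#
  *-nonzero x≢0 y≢0 xy = y≢0 (no-zero-divisors xy x≢0)

  private
    module Sum = Algebra.Properties.CommutativeMonoid.Sum +-commutativeMonoid
    open Algebra.Properties.Semiring.Mult semiring using (×1-homo-*) renaming (_×_ to _·_)

  -- Translation by 1 permutes the field, so Σ x = Σ (x + 1) = Σ x + q·1.
  order×1 : q · 1# ≡ 0#
  order×1 = ∙-cancelˡ (Sum.sum to) _ _ (sym (begin
    Sum.sum to + 0#                        ≡⟨ +-identityʳ _ ⟩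
    Sum.sum to                             ≡⟨ Sum.sum-permute to shift ⟩
    Sum.sum (λ i → to (from (to i + 1#)))  ≡⟨ Sum.sum-cong-≗ (λ i → strictlyInverseˡ (to i + 1#)) ⟩
    Sum.sum (λ i → to i + 1#)              ≡⟨ Sum.∑-distrib-+ to (λ _ → 1#) ⟩
    Sum.sum to + Sum.sum {q} (λ _ → 1#)    ≡⟨ cong (Sum.sum to +_) (Sum.sum-replicate q) ⟩
    Sum.sum to + q · 1#                    ∎))
    where
    open ≡-Reasoning
    cancel : ∀ x y z → y + z ≡ 0# → x + y + z ≡ x
    cancel x y z e = trans (+-assoc x y z) (trans (cong (x +_) e) (+-identityʳ x))
    shift : Permutation q q
    shift = permutation (λ i → from (to i + 1#)) (λ i → from (to i + - 1#))
      (λ i → trans (cong (λ x → from (x + 1#)) (strictlyInverseˡ (to i + - 1#)))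
               (trans (cong from (cancel (to i) (- 1#) 1# (-‿inverseˡ 1#))) (strictlyInverseʳ i)))
      (λ i → trans (cong (λ x → from (x + - 1#)) (strictlyInverseˡ (to i + 1#)))
               (trans (cong from (cancel (to i) 1# (- 1#) (-‿inverseʳ 1#))) (strictlyInverseʳ i)))

  -- Otherwise `(2 ^ n) · 1#`, a product of nonzero factors, would be nonzero for every n, against
  -- `order×1`.
  1+1≡0 : 1# + 1# ≡ 0#
  1+1≡0 with 1# + 1# ≟ 0#
  ... | yes eq = eq
  ... | no ne = contradiction (subst (λ n → n · 1# ≡ 0#) q≡ order×1) (power (suc h))
    where
    power : ∀ n → (2 ^ n) · 1# ≢ 0#
    power zero    eq = 0≢1 (trans (sym eq) (+-identityʳ 1#))
    power (suc n) eq = *-nonzero (λ e → ne (trans (cong (1# +_) (sym (+-identityʳ 1#))) e)) (power n)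
      (trans (sym (×1-homo-* 2 (2 ^ n))) eq)

  -- Booleans under xor and ∧ form GF(2). Taking them as the coefficients of the ring solver lets it
  -- cancel equal terms and ignore signs.
  ⟦_⟧₂ : Bool → Carrier
  ⟦ false ⟧₂ = 0#
  ⟦ true  ⟧₂ = 1#

  private
    almostCommutativeRing : AlmostCommutativeRing 0ℓ 0ℓ
    almostCommutativeRing = fromCommutativeRing commutativeRing

    -1≡1 : - 1# ≡ 1#
    -1≡1 = ∙-cancelˡ 1# _ _ (trans (-‿inverseʳ 1#) (sym 1+1≡0))

    𝔽₂-morphism : CommutativeRing.rawRing xor-∧-commutativeRing -Raw-AlmostCommutative⟶ almostCommutativeRing
    𝔽₂-morphism = record
      { ⟦_⟧    = ⟦_⟧₂
      ; +-homo = λ { false y → sym (+-identityˡ _)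
                   ; true false → sym (+-identityʳ _)
                   ; true true → sym 1+1≡0 }
      ; *-homo = λ { false y → sym (zeroˡ _) ; true y → sym (*-identityˡ _) }
      ; -‿homo = λ { false → trans (sym (-‿inverseʳ 0#)) (+-identityˡ _) ; true → sym -1≡1 }
      ; 0-homo = refl
      ; 1-homo = refl
      }

    𝔽₂≟ : ∀ b c → Maybe (⟦ b ⟧₂ ≡ ⟦ c ⟧₂)
    𝔽₂≟ false false = just refl
    𝔽₂≟ true  true  = just refl
    𝔽₂≟ _     _     = nothing

  open Algebra.Solver.Ring (CommutativeRing.rawRing xor-∧-commutativeRing) almostCommutativeRing 𝔽₂-morphism 𝔽₂≟ public
    using (solve; _:=_; _:+_; _:*_; :-_; con)

  -x≡x : ∀ x → - x ≡ x
  -x≡x = solve 1 (λ x → :- x := x) refl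

  x+y≡0⇒x≡y : ∀ {x y} → x + y ≡ 0# → x ≡ y
  x+y≡0⇒x≡y {x} {y} eq = trans (solve 2 (λ x y → x := (x :+ y) :+ y) refl x y)
    (trans (cong (_+ y) eq) (+-identityˡ y))

  x≡y⇒x+y≡0 : ∀ {x y} → x ≡ y → x + y ≡ 0#
  x≡y⇒x+y≡0 {x} refl = solve 1 (λ x → x :+ x := con false) refl x

  square-injective : ∀ {x y} → x * x ≡ y * y → x ≡ y
  square-injective {x} {y} eq with x + y ≟ 0#
  ... | yes e = x+y≡0⇒x≡y e
  ... | no ne = contradiction
    (trans (solve 2 (λ x y → (x :+ y) :* (x :+ y) := x :* x :+ y :* y) refl x y) (x≡y⇒x+y≡0 eq))
    (*-nonzero ne ne)

  square≡0 : ∀ {x} → x * x ≡ 0# → x ≡ 0#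
  square≡0 xx = square-injective (trans xx (sym (zeroˡ 0#)))

  -- Pigeonhole: squaring is injective, so a non-square together with all the squares would make q +
  -- 1 distinct elements.
  sqrt : ∀ y → ∃ λ x → x * x ≡ y
  sqrt y with Finₚ.any? (λ i → to i * to i ≟ y)
  ... | yes (i , eq) = to i , eq
  ... | no none = contradiction (Finₚ.injective⇒≤ {f = squares} squares-injective) ℕₚ.1+n≰n
    where
    value : Fin (suc q) → Carrier
    value zero    = y
    value (suc i) = to i * to i
    squares : Fin (suc q) → Fin q
    squares i = from (value i)
    from-injective : ∀ {a b} → from a ≡ from b → a ≡ b
    from-injective {a} {b} eq = trans (sym (strictlyInverseˡ a)) (trans (cong to eq) (strictlyInverseˡ b))
    to-injective : ∀ {a b} → to a ≡ to b → a ≡ b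
    to-injective {a} {b} eq = trans (sym (strictlyInverseʳ a)) (trans (cong from eq) (strictlyInverseʳ b))
    squares-injective : ∀ {i j} → squares i ≡ squares j → i ≡ j
    squares-injective {zero}  {zero}  eq = refl
    squares-injective {zero}  {suc j} eq = contradiction (j , sym (from-injective eq)) none
    squares-injective {suc i} {zero}  eq = contradiction (i , from-injective eq) none
    squares-injective {suc i} {suc j} eq = cong suc (to-injective (square-injective (from-injective eq)))

  cramer : ∀ {s t s' t' x y} → s * t' + t * s' ≢ 0# →
           t * x + s * y ≡ 0# → t' * x + s' * y ≡ 0# → x ≡ 0# × y ≡ 0#
  cramer {s} {t} {s'} {t'} {x} {y} ≢0 e e' =
    no-zero-divisors (trans
      (solve 6 (λ s t s' t' x y → (s :* t' :+ t :* s') :* x :=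
         s :* (t' :* x :+ s' :* y) :+ s' :* (t :* x :+ s :* y)) refl s t s' t' x y)
      (zero-combination s s' e' e)) ≢0 ,
    no-zero-divisors (trans
      (solve 6 (λ s t s' t' x y → (s :* t' :+ t :* s') :* y :=
         t :* (t' :* x :+ s' :* y) :+ t' :* (t :* x :+ s :* y)) refl s t s' t' x y)
      (zero-combination t t' e' e)) ≢0
    where
    zero-combination : ∀ a b {u v} → u ≡ 0# → v ≡ 0# → a * u + b * v ≡ 0#
    zero-combination a b refl refl = trans (cong₂ _+_ (zeroʳ a) (zeroʳ b)) (+-identityʳ 0#)

-- Normal form of a non-singular conic in characteristic 2.

module ConicFrames {q : ℕ} (𝔽 : FiniteField q) (h : ℕ) (q≡ : q ≡ 2 ^ suc h) where
  open Geom 𝔽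
  open CharacteristicTwo 𝔽 h q≡
  open CommutativeRing commutativeRing
    using (+-comm; *-assoc; *-identityˡ; zeroˡ; zeroʳ)

  Mat3 : Set
  Mat3 = Fin 3 → Fin 3 → Carrier

  mul : Mat3 → Vec 3 → Vec 3
  mul M v i = M i 0F * v 0F + M i 1F * v 1F + M i 2F * v 2F

  mul-cong : ∀ M {u v} → u ≐ v → mul M u ≐ mul M v
  mul-cong M eq i = cong₂ _+_ (cong₂ _+_ (cong (M i 0F *_) (eq 0F)) (cong (M i 1F *_) (eq 1F))) (cong (M i 2F *_) (eq 2F))

  -- Coordinates x , y , z = T v in which the conic is y² = xz; the point
  -- (0, 1, 0) is its nucleus.
  record Frame (C : TernaryForm) : Set where
    field
      T U    : Mat3
      UT     : ∀ v → mul U (mul T v) ≐ v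
      TU     : ∀ w → mul T (mul U w) ≐ w
      μ      : Carrier
      μ≢0    : μ ≢ 0#
      form-T : ∀ v → form C v ≡ μ * (mul T v 0F * mul T v 2F + mul T v 1F * mul T v 1F)

  quotient : ∀ {x} y → x ≢ 0# → ∃ λ z → x * z ≡ y
  quotient {x} y x≢0 with inverse x x≢0
  ... | i , xi = i * y , trans (sym (*-assoc x i y)) (trans (cong (_* y) xi) (*-identityˡ y))

  sqrt-quotient : ∀ {x} y → x ≢ 0# → ∃ λ z → x * (z * z) ≡ y
  sqrt-quotient {x} y x≢0 with quotient y x≢0
  ... | w , xw with sqrt w
  ...   | z , zz = z , trans (cong (x *_) zz) xw

  module Normalise
    (C : TernaryForm) (nonSingular : NonSingular C) (c12≢0 : c12 C ≢ 0#) where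

    private
      -- In characteristic 2 the partial derivatives are given by an alternating matrix with kernel
      -- vector (c12, c02, c01). Scaled to (1, `n₁`, `n₂`) this is the nucleus, and `ν` is the value
      -- of the form there.
      μ n₁ n₂ a b ν : Carrier
      μ  = c12 C
      n₁ = proj₁ (quotient (c02 C) c12≢0)
      n₂ = proj₁ (quotient (c01 C) c12≢0)
      a  = proj₁ (sqrt-quotient (c11 C) c12≢0)
      b  = proj₁ (sqrt-quotient (c22 C) c12≢0)
      ν  = c00 C + c11 C * (n₁ * n₁) + c22 C * (n₂ * n₂) + μ * (n₁ * n₂)

      c02≡ : c02 C ≡ μ * n₁
      c02≡ = sym (proj₂ (quotient (c02 C) c12≢0))
      c01≡ : c01 C ≡ μ * n₂
      c01≡ = sym (proj₂ (quotient (c01 C) c12≢0))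
      c11≡ : c11 C ≡ μ * (a * a)
      c11≡ = sym (proj₂ (sqrt-quotient (c11 C) c12≢0))
      c22≡ : c22 C ≡ μ * (b * b)
      c22≡ = sym (proj₂ (sqrt-quotient (c22 C) c12≢0))

    nucleus : Vec 3
    nucleus 0F = 1#
    nucleus 1F = n₁
    nucleus 2F = n₂

    private
      form-nucleus : form C nucleus ≡ ν
      form-nucleus = go c01≡ c02≡
        where
        go : ∀ {d e} → d ≡ μ * n₂ → e ≡ μ * n₁ →
             c00 C * 1# * 1# + c11 C * n₁ * n₁ + c22 C * n₂ * n₂ + d * 1# * n₁ + e * 1# * n₂ + μ * n₁ * n₂ ≡ ν
        go refl refl = solve 6 (λ k l m μ s t →
          k :* con true :* con true :+ l :* s :* s :+ m :* t :* t :+ μ :* t :* con true :* s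
            :+ μ :* s :* con true :* t :+ μ :* s :* t
          := k :+ l :* (s :* s) :+ m :* (t :* t) :+ μ :* (s :* t)) refl (c00 C) (c11 C) (c22 C) μ n₁ n₂

      ∂0≡0 : ∂0 C nucleus ≡ 0#
      ∂0≡0 = go c01≡ c02≡
        where
        go : ∀ {d e} → d ≡ μ * n₂ → e ≡ μ * n₁ → (c00 C + c00 C) * 1# + d * n₁ + e * n₂ ≡ 0#
        go refl refl = solve 4 (λ k μ s t →
          (k :+ k) :* con true :+ μ :* t :* s :+ μ :* s :* t := con false) refl (c00 C) μ n₁ n₂

      ∂1≡0 : ∂1 C nucleus ≡ 0#
      ∂1≡0 = go c01≡
        where
        go : ∀ {d} → d ≡ μ * n₂ → d * 1# + (c11 C + c11 C) * n₁ + μ * n₂ ≡ 0#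
        go refl = solve 4 (λ k μ s t →
          μ :* t :* con true :+ (k :+ k) :* s :+ μ :* t := con false) refl (c11 C) μ n₁ n₂

      ∂2≡0 : ∂2 C nucleus ≡ 0#
      ∂2≡0 = go c02≡
        where
        go : ∀ {d} → d ≡ μ * n₁ → d * 1# + μ * n₁ + (c22 C + c22 C) * n₂ ≡ 0#
        go refl = solve 4 (λ k μ s t →
          μ :* s :* con true :+ μ :* s :+ (k :+ k) :* t := con false) refl (c22 C) μ n₁ n₂

      -- All partial derivatives vanish at the nucleus, so on the conic it would be a singular
      -- point.
      ν≢0 : ν ≢ 0#
      ν≢0 ν≡0 = nonSingular nucleus (λ z → 0≢1 (sym (z 0F))) (trans form-nucleus ν≡0) (∂0≡0 , ∂1≡0 , ∂2≡0)

      σ τ : Carrier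
      σ = proj₁ (sqrt-quotient ν c12≢0)

      σ≡ : μ * (σ * σ) ≡ ν
      σ≡ = proj₂ (sqrt-quotient ν c12≢0)

      σ≢0 : σ ≢ 0#
      σ≢0 eq = ν≢0 (trans (sym σ≡) (trans (cong (λ s → μ * (s * s)) eq)
        (trans (cong (μ *_) (zeroˡ 0#)) (zeroʳ μ))))

      τ = proj₁ (inverse σ σ≢0)

      στ : σ * τ ≡ 1#
      στ = proj₂ (inverse σ σ≢0)

      c00≡ : c00 C ≡ μ * (σ * σ) + μ * (a * a) * (n₁ * n₁) + μ * (b * b) * (n₂ * n₂) + μ * (n₁ * n₂)
      c00≡ = trans
        (solve 4 (λ k l m n → k := (k :+ l :+ m :+ n) :+ l :+ m :+ n) refl
          (c00 C) (c11 C * (n₁ * n₁)) (c22 C * (n₂ * n₂)) (μ * (n₁ * n₂)))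
        (cong (_+ μ * (n₁ * n₂)) (cong₂ _+_ (cong₂ _+_ (sym σ≡) (cong (_* (n₁ * n₁)) c11≡)) (cong (_* (n₂ * n₂)) c22≡)))

      -- The product of rows 0 and 2 absorbs all mixed terms of the form divided by `μ`. What
      -- remains is diagonal, hence the square of a linear form, which is row 1. The nucleus is sent
      -- to (0, σ, 0), so σ ≠ 0 makes `T` invertible.
      T U : Mat3
      T 0F 0F = n₁
      T 0F 1F = 1#
      T 0F 2F = 0#
      T 1F 0F = σ + a * n₁ + b * n₂
      T 1F 1F = a
      T 1F 2F = b
      T 2F 0F = n₂
      T 2F 1F = 0#
      T 2F 2F = 1#
      U 0F 0F = τ * a
      U 0F 1F = τ
      U 0F 2F = τ * b
      U 1F 0F = 1# + n₁ * τ * a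
      U 1F 1F = n₁ * τ
      U 1F 2F = n₁ * τ * b
      U 2F 0F = n₂ * τ * a
      U 2F 1F = n₂ * τ
      U 2F 2F = 1# + n₂ * τ * b

      -- The ring solver cannot use σ τ = 1. Each identity is therefore proved up to an explicit
      -- multiple `z` of σ τ + 1.
      modulo-στ : ∀ {x y} z → x ≡ y + (σ * τ + 1#) * z → x ≡ y
      modulo-στ {x} {y} z eq = trans eq (trans
        (cong (λ r → y + (r + 1#) * z) στ)
        (solve 2 (λ y z → y :+ (con true :+ con true) :* z := y) refl y z))

      UT : ∀ v → mul U (mul T v) ≐ v
      UT v = λ
        { 0F → modulo-στ (v 0F) (solve 9 (λ s t a b n m x y z →
            let T0 = n :* x :+ con true :* y :+ con false :* z
                T1 = (s :+ a :* n :+ b :* m) :* x :+ a :* y :+ b :* z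
                T2 = m :* x :+ con false :* y :+ con true :* z
            in t :* a :* T0 :+ t :* T1 :+ t :* b :* T2 := x :+ (s :* t :+ con true) :* x)
            refl σ τ a b n₁ n₂ (v 0F) (v 1F) (v 2F))
        ; 1F → modulo-στ (n₁ * v 0F) (solve 9 (λ s t a b n m x y z →
            let T0 = n :* x :+ con true :* y :+ con false :* z
                T1 = (s :+ a :* n :+ b :* m) :* x :+ a :* y :+ b :* z
                T2 = m :* x :+ con false :* y :+ con true :* z
            in (con true :+ n :* t :* a) :* T0 :+ n :* t :* T1 :+ n :* t :* b :* T2 := y :+ (s :* t :+ con true) :* (n :* x))
            refl σ τ a b n₁ n₂ (v 0F) (v 1F) (v 2F))
        ; 2F → modulo-στ (n₂ * v 0F) (solve 9 (λ s t a b n m x y z →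
            let T0 = n :* x :+ con true :* y :+ con false :* z
                T1 = (s :+ a :* n :+ b :* m) :* x :+ a :* y :+ b :* z
                T2 = m :* x :+ con false :* y :+ con true :* z
            in m :* t :* a :* T0 :+ m :* t :* T1 :+ (con true :+ m :* t :* b) :* T2 := z :+ (s :* t :+ con true) :* (m :* x))
            refl σ τ a b n₁ n₂ (v 0F) (v 1F) (v 2F))
        }

      TU : ∀ w → mul T (mul U w) ≐ w
      TU w = λ
        { 0F → solve 9 (λ s t a b n m x y z →
            let U0 = t :* a :* x :+ t :* y :+ t :* b :* z
                U1 = (con true :+ n :* t :* a) :* x :+ n :* t :* y :+ n :* t :* b :* z
                U2 = m :* t :* a :* x :+ m :* t :* y :+ (con true :+ m :* t :* b) :* z
            in n :* U0 :+ con true :* U1 :+ con false :* U2 := x)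
            refl σ τ a b n₁ n₂ (w 0F) (w 1F) (w 2F)
        ; 1F → modulo-στ (a * w 0F + w 1F + b * w 2F) (solve 9 (λ s t a b n m x y z →
            let U0 = t :* a :* x :+ t :* y :+ t :* b :* z
                U1 = (con true :+ n :* t :* a) :* x :+ n :* t :* y :+ n :* t :* b :* z
                U2 = m :* t :* a :* x :+ m :* t :* y :+ (con true :+ m :* t :* b) :* z
            in (s :+ a :* n :+ b :* m) :* U0 :+ a :* U1 :+ b :* U2
                 := y :+ (s :* t :+ con true) :* (a :* x :+ y :+ b :* z))
            refl σ τ a b n₁ n₂ (w 0F) (w 1F) (w 2F))
        ; 2F → solve 9 (λ s t a b n m x y z →
            let U0 = t :* a :* x :+ t :* y :+ t :* b :* z
                U1 = (con true :+ n :* t :* a) :* x :+ n :* t :* y :+ n :* t :* b :* z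
                U2 = m :* t :* a :* x :+ m :* t :* y :+ (con true :+ m :* t :* b) :* z
            in m :* U0 :+ con false :* U1 :+ con true :* U2 := z)
            refl σ τ a b n₁ n₂ (w 0F) (w 1F) (w 2F)
        }

      form-T : ∀ v → form C v ≡ μ * (mul T v 0F * mul T v 2F + mul T v 1F * mul T v 1F)
      form-T v = go (v 0F) (v 1F) (v 2F) c00≡ c11≡ c22≡ c01≡ c02≡
        where
        go : ∀ x y z {c00 c11 c22 c01 c02} →
          c00 ≡ μ * (σ * σ) + μ * (a * a) * (n₁ * n₁) + μ * (b * b) * (n₂ * n₂) + μ * (n₁ * n₂) →
          c11 ≡ μ * (a * a) → c22 ≡ μ * (b * b) → c01 ≡ μ * n₂ → c02 ≡ μ * n₁ →
          c00 * x * x + c11 * y * y + c22 * z * z + c01 * x * y + c02 * x * z + μ * y * z ≡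
          μ * ((n₁ * x + 1# * y + 0# * z) * (n₂ * x + 0# * y + 1# * z)
             + ((σ + a * n₁ + b * n₂) * x + a * y + b * z) * ((σ + a * n₁ + b * n₂) * x + a * y + b * z))
        go x y z refl refl refl refl refl = solve 9 (λ μ s a b n m x y z →
          (μ :* (s :* s) :+ μ :* (a :* a) :* (n :* n) :+ μ :* (b :* b) :* (m :* m) :+ μ :* (n :* m)) :* x :* x
            :+ μ :* (a :* a) :* y :* y :+ μ :* (b :* b) :* z :* z :+ μ :* m :* x :* y :+ μ :* n :* x :* z :+ μ :* y :* z
          := μ :* ((n :* x :+ con true :* y :+ con false :* z) :* (m :* x :+ con false :* y :+ con true :* z)
             :+ ((s :+ a :* n :+ b :* m) :* x :+ a :* y :+ b :* z) :* ((s :+ a :* n :+ b :* m) :* x :+ a :* y :+ b :* z)))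
          refl μ σ a b n₁ n₂ x y z

    frame : Frame C
    frame = record { T = T ; U = U ; UT = UT ; TU = TU ; μ = μ ; μ≢0 = c12≢0 ; form-T = form-T }

  -- Coordinate swaps reduce the case of any nonzero mixed coefficient to that of `c12`.
  record Involution : Set where
    field
      σ        : Fin 3 → Fin 3
      σσ       : ∀ i → σ (σ i) ≡ i
      sum-σ    : ∀ (f : Vec 3) → f (σ 0F) + f (σ 1F) + f (σ 2F) ≡ f 0F + f 1F + f 2F

  swap01 swap02 : Involution
  swap01 = record
    { σ = λ { 0F → 1F ; 1F → 0F ; 2F → 2F }
    ; σσ = λ { 0F → refl ; 1F → refl ; 2F → refl }
    ; sum-σ = λ f → cong (_+ f 2F) (+-comm (f 1F) (f 0F)) }
  swap02 = record
    { σ = λ { 0F → 2F ; 1F → 1F ; 2F → 0F }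
    ; σσ = λ { 0F → refl ; 1F → refl ; 2F → refl }
    ; sum-σ = λ f → solve 3 (λ x y z → z :+ y :+ x := x :+ y :+ z) refl (f 0F) (f 1F) (f 2F) }

  permute-frame : ∀ {C C'} (s : Involution) → let open Involution s in
    (∀ v → form C' (λ i → v (σ i)) ≡ form C v) → Frame C' → Frame C
  permute-frame {C} {C'} s form-σ F' = record
    { T = T ; U = U ; UT = UT ; TU = TU ; μ = F'.μ ; μ≢0 = F'.μ≢0
    ; form-T = λ v → trans (sym (form-σ v)) (trans (F'.form-T (λ i → v (σ i)))
        (cong (F'.μ *_) (sym (cong₂ _+_ (cong₂ _*_ (mulT v 0F) (mulT v 2F)) (cong₂ _*_ (mulT v 1F) (mulT v 1F))))))
    }
    where
    open Involution s
    module F' = Frame F'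
    T U : Mat3
    T i j = F'.T i (σ j)
    U i j = F'.U (σ i) j
    mulT : ∀ v → mul T v ≐ mul F'.T (λ i → v (σ i))
    mulT v i = trans (sym (sum-σ (λ j → F'.T i (σ j) * v j)))
      (cong₂ _+_ (cong₂ _+_ (cong (λ k → F'.T i k * v (σ 0F)) (σσ 0F)) (cong (λ k → F'.T i k * v (σ 1F)) (σσ 1F)))
        (cong (λ k → F'.T i k * v (σ 2F)) (σσ 2F)))
    UT : ∀ v → mul U (mul T v) ≐ v
    UT v i = trans (mul-cong U (mulT v) i) (trans (F'.UT (λ j → v (σ j)) (σ i)) (cong v (σσ i)))
    TU : ∀ w → mul T (mul U w) ≐ w
    TU w i = trans (mulT (mul U w) i)
      (trans (mul-cong F'.T (λ j → cong (λ k → mul F'.U w k) (σσ j)) i) (F'.TU w i))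

  permuted01 permuted02 : TernaryForm → TernaryForm
  permuted01 C = record
    { c00 = c11 C ; c11 = c00 C ; c22 = c22 C ; c01 = c01 C ; c02 = c12 C ; c12 = c02 C }
  permuted02 C = record
    { c00 = c22 C ; c11 = c11 C ; c22 = c00 C ; c01 = c12 C ; c02 = c02 C ; c12 = c01 C }

  form-swap01 : ∀ C v → form (permuted01 C) (λ i → v (Involution.σ swap01 i)) ≡ form C v
  form-swap01 C v = solve 9 (λ k l m d e f x y z →
    l :* y :* y :+ k :* x :* x :+ m :* z :* z :+ d :* y :* x :+ f :* y :* z :+ e :* x :* z
    := k :* x :* x :+ l :* y :* y :+ m :* z :* z :+ d :* x :* y :+ e :* x :* z :+ f :* y :* z)
    refl (c00 C) (c11 C) (c22 C) (c01 C) (c02 C) (c12 C) (v 0F) (v 1F) (v 2F)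

  form-swap02 : ∀ C v → form (permuted02 C) (λ i → v (Involution.σ swap02 i)) ≡ form C v
  form-swap02 C v = solve 9 (λ k l m d e f x y z →
    m :* z :* z :+ l :* y :* y :+ k :* x :* x :+ f :* z :* y :+ e :* z :* x :+ d :* y :* x
    := k :* x :* x :+ l :* y :* y :+ m :* z :* z :+ d :* x :* y :+ e :* x :* z :+ f :* y :* z)
    refl (c00 C) (c11 C) (c22 C) (c01 C) (c02 C) (c12 C) (v 0F) (v 1F) (v 2F)

  nonzero-σ : ∀ (s : Involution) {v : Vec 3} → NonZero v → NonZero (λ i → v (Involution.σ s i))
  nonzero-σ s {v} nz z = nz (λ i → trans (cong v (sym (σσ i))) (z (σ i)))
    where open Involution s

  nonSingular-permuted01 : ∀ C → NonSingular C → NonSingular (permuted01 C)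
  nonSingular-permuted01 C ns x nz fx (d0 , d1 , d2) =
    ns x' (nonzero-σ swap01 nz)
      (trans (sym (form-swap01 C x')) fx)
      ( trans (solve 6 (λ k l m x y z → k :* x :+ l :* y :+ m :* z := l :* y :+ k :* x :+ m :* z) refl
          (c00 C + c00 C) (c01 C) (c02 C) (x 1F) (x 0F) (x 2F)) d1
      , trans (solve 6 (λ k l m x y z → k :* x :+ l :* y :+ m :* z := l :* y :+ k :* x :+ m :* z) refl
          (c01 C) (c11 C + c11 C) (c12 C) (x 1F) (x 0F) (x 2F)) d0
      , trans (solve 6 (λ k l m x y z → k :* x :+ l :* y :+ m :* z := l :* y :+ k :* x :+ m :* z) refl
          (c02 C) (c12 C) (c22 C + c22 C) (x 1F) (x 0F) (x 2F)) d2)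
    where
    x' : Vec 3
    x' i = x (Involution.σ swap01 i)

  nonSingular-permuted02 : ∀ C → NonSingular C → NonSingular (permuted02 C)
  nonSingular-permuted02 C ns x nz fx (d0 , d1 , d2) =
    ns x' (nonzero-σ swap02 nz)
      (trans (sym (form-swap02 C x')) fx)
      ( trans (solve 6 (λ k l m x y z → k :* x :+ l :* y :+ m :* z := m :* z :+ l :* y :+ k :* x) refl
          (c00 C + c00 C) (c01 C) (c02 C) (x 2F) (x 1F) (x 0F)) d2
      , trans (solve 6 (λ k l m x y z → k :* x :+ l :* y :+ m :* z := m :* z :+ l :* y :+ k :* x) refl
          (c01 C) (c11 C + c11 C) (c12 C) (x 2F) (x 1F) (x 0F)) d1
      , trans (solve 6 (λ k l m x y z → k :* x :+ l :* y :+ m :* z := m :* z :+ l :* y :+ k :* x) refl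
          (c02 C) (c12 C) (c22 C + c22 C) (x 2F) (x 1F) (x 0F)) d0)
    where
    x' : Vec 3
    x' i = x (Involution.σ swap02 i)

  singular-point : ∀ C → c01 C ≡ 0# → c02 C ≡ 0# → c12 C ≡ 0# → NonSingular C →
    ∀ s t → (s ≡ 0# → t ≡ 0# → ⊥) → c00 C * (s * s) + c11 C * (t * t) ≡ 0# → ⊥
  singular-point C e01 e02 e12 ns s t nz zero-form =
    ns p (λ z → nz (z 0F) (z 1F)) (trans (form-p e01 e02 e12) zero-form)
      (∂0≡0 e01 e02 , ∂1≡0 e01 e12 , ∂2≡0 e02 e12)
    where
    p : Vec 3
    p 0F = s
    p 1F = t
    p 2F = 0#
    form-p : ∀ {d e f} → d ≡ 0# → e ≡ 0# → f ≡ 0# →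
      c00 C * s * s + c11 C * t * t + c22 C * 0# * 0# + d * s * t + e * s * 0# + f * t * 0# ≡
      c00 C * (s * s) + c11 C * (t * t)
    form-p refl refl refl = solve 5 (λ k l m s t →
      k :* s :* s :+ l :* t :* t :+ m :* con false :* con false :+ con false :* s :* t
        :+ con false :* s :* con false :+ con false :* t :* con false
      := k :* (s :* s) :+ l :* (t :* t)) refl (c00 C) (c11 C) (c22 C) s t
    ∂0≡0 : ∀ {d e} → d ≡ 0# → e ≡ 0# → (c00 C + c00 C) * s + d * t + e * 0# ≡ 0#
    ∂0≡0 refl refl = solve 3 (λ k s t →
      (k :+ k) :* s :+ con false :* t :+ con false :* con false := con false) refl (c00 C) s t
    ∂1≡0 : ∀ {d e} → d ≡ 0# → e ≡ 0# → d * s + (c11 C + c11 C) * t + e * 0# ≡ 0#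
    ∂1≡0 refl refl = solve 3 (λ k s t →
      con false :* s :+ (k :+ k) :* t :+ con false :* con false := con false) refl (c11 C) s t
    ∂2≡0 : ∀ {d e} → d ≡ 0# → e ≡ 0# → d * s + e * t + (c22 C + c22 C) * 0# ≡ 0#
    ∂2≡0 refl refl = solve 3 (λ k s t →
      con false :* s :+ con false :* t :+ (k :+ k) :* con false := con false) refl (c22 C) s t

  -- Without mixed terms the form is the square of a linear form, which is singular at each of its zeros.
  diagonal-singular : ∀ C → c01 C ≡ 0# → c02 C ≡ 0# → c12 C ≡ 0# → ¬ NonSingular C
  diagonal-singular C e01 e02 e12 ns with c00 C ≟ 0#
  ... | yes e00 = singular-point C e01 e02 e12 ns 1# 0# (λ e _ → 0≢1 (sym e))
        (trans (cong (λ k → k * (1# * 1#) + c11 C * (0# * 0#)) e00)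
          (solve 1 (λ k → con false :* (con true :* con true) :+ k :* (con false :* con false) := con false) refl (c11 C)))
  -- The point is (√c11, √c00, 0), at which the two remaining terms are both c00 c11 and cancel.
  ... | no ne = singular-point C e01 e02 e12 ns s t
        (λ _ t≡0 → ne (trans (sym tt) (trans (cong (λ x → x * x) t≡0) (zeroˡ 0#))))
        (trans (cong₂ _+_ (cong (c00 C *_) ss) (cong (c11 C *_) tt))
          (solve 2 (λ k l → k :* l :+ l :* k := con false) refl (c00 C) (c11 C)))
    where
    s t : Carrier
    s = proj₁ (sqrt (c11 C))
    t = proj₁ (sqrt (c00 C))
    ss : s * s ≡ c11 C
    ss = proj₂ (sqrt (c11 C))
    tt : t * t ≡ c00 C
    tt = proj₂ (sqrt (c00 C))

  frame : ∀ C → NonSingular C → Frame C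
  frame C ns with c12 C ≟ 0# | c02 C ≟ 0# | c01 C ≟ 0#
  ... | no ne  | _      | _      = Normalise.frame C ns ne
  ... | yes _  | no ne  | _      = permute-frame swap01 (form-swap01 C)
          (Normalise.frame (permuted01 C) (nonSingular-permuted01 C ns) ne)
  ... | yes _  | yes _  | no ne  = permute-frame swap02 (form-swap02 C)
          (Normalise.frame (permuted02 C) (nonSingular-permuted02 C ns) ne)
  ... | yes e  | yes e' | yes e'' = contradiction ns (diagonal-singular C e'' e' e)

-- Linear equations for the two reguli, and the quadric.

module Reguli {q : ℕ} (𝔽 : FiniteField q) (h : ℕ) (q≡ : q ≡ 2 ^ suc h) where
  open Geom 𝔽
  open CharacteristicTwo 𝔽 h q≡
  open ConicFrames 𝔽 h q≡
  open CommutativeRing commutativeRing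
    using (+-identityˡ; *-assoc; *-comm; *-identityˡ; *-identityʳ; zeroˡ; zeroʳ)

  -- The image under M of c (s², st, t²), in frame coordinates.
  conicPt : (c s t : Carrier) → Vec 4
  conicPt c s t 0F = c * (s * s)
  conicPt c s t 1F = c * (t * t)
  conicPt c s t 2F = c * (s * t)
  conicPt c s t 3F = c * (s * t)

  -- With the images under `M` for `W` and `X`, these unfold to `CommonR` and `CommonR'`, so the
  -- reguli can be studied without `M`.
  Rulingˡ Rulingʳ : Vec 4 → Vec 4 → Set
  Rulingˡ W X = ∃ λ u → NonZero u × ∃ λ v → ∃ λ v' → W ≐ φ u v × X ≐ φ u v'
  Rulingʳ W X = ∃ λ v → NonZero v × ∃ λ u → ∃ λ u' → W ≐ φ u v × X ≐ φ u' v

  pair : Carrier → Carrier → Vec 2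
  pair a b 0F = a
  pair a b 1F = b

  module _ {c s t : Carrier} (c≢0 : c ≢ 0#) (st≢0 : s ≡ 0# → t ≡ 0# → ⊥) where

    -- Up to sign `φ u v` is the 2×2 matrix with rows (X0, X2) = u₀ v and (X3, X1) = u₁ v. The point
    -- at infinity forces `u` to be proportional to (s, t), and the equations say that the rows are
    -- in this ratio.
    rulingˡ⇒ : ∀ {W X} → W ≐ conicPt c s t → Rulingˡ W X →
               t * X 0F + s * X 3F ≡ 0# × t * X 2F + s * X 1F ≡ 0#
    rulingˡ⇒ {W} {X} W≐ (u , _ , v , v' , W≐φ , X≐φ) = on₀ , on₁
      where
      D : Carrier
      D = t * u 0F + s * u 1F
      e : ∀ i → φ u v i ≡ conicPt c s t i
      e i = trans (sym (W≐φ i)) (W≐ i)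
      Dv₀ : D * v 0F ≡ 0#
      Dv₀ = trans
        (solve 5 (λ s t u₀ u₁ v₀ → (t :* u₀ :+ s :* u₁) :* v₀ := t :* (u₀ :* v₀) :+ s :* (:- (u₁ :* v₀))) refl s t (u 0F) (u 1F) (v 0F))
        (trans (cong₂ (λ a b → t * a + s * b) (e 0F) (e 3F))
          (solve 3 (λ c s t → t :* (c :* (s :* s)) :+ s :* (c :* (s :* t)) := con false) refl c s t))
      Dv₁ : D * v 1F ≡ 0#
      Dv₁ = trans
        (solve 5 (λ s t u₀ u₁ v₁ → (t :* u₀ :+ s :* u₁) :* v₁ := t :* (u₀ :* v₁) :+ s :* (u₁ :* v₁)) refl s t (u 0F) (u 1F) (v 1F))
        (trans (cong₂ (λ a b → t * a + s * b) (e 2F) (e 1F))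
          (solve 3 (λ c s t → t :* (c :* (s :* t)) :+ s :* (c :* (t :* t)) := con false) refl c s t))
      -- If `D` were nonzero, `v` would vanish, hence also c s² and c t².
      D≡0 : D ≡ 0#
      D≡0 with D ≟ 0#
      ... | yes eq = eq
      ... | no D≢0 = contradiction
              (square≡0 (no-zero-divisors (trans (sym (e 1F)) (trans (cong (u 1F *_) (no-zero-divisors Dv₁ D≢0)) (zeroʳ _))) c≢0))
              (st≢0 (square≡0 (no-zero-divisors (trans (sym (e 0F)) (trans (cong (u 0F *_) (no-zero-divisors Dv₀ D≢0)) (zeroʳ _))) c≢0)))
      on₀ : t * X 0F + s * X 3F ≡ 0#
      on₀ = trans (cong₂ (λ a b → t * a + s * b) (X≐φ 0F) (X≐φ 3F)) (trans
        (solve 5 (λ s t u₀ u₁ v₀ → t :* (u₀ :* v₀) :+ s :* (:- (u₁ :* v₀)) := (t :* u₀ :+ s :* u₁) :* v₀) refl s t (u 0F) (u 1F) (v' 0F))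
        (trans (cong (_* v' 0F) D≡0) (zeroˡ _)))
      on₁ : t * X 2F + s * X 1F ≡ 0#
      on₁ = trans (cong₂ (λ a b → t * a + s * b) (X≐φ 2F) (X≐φ 1F)) (trans
        (solve 5 (λ s t u₀ u₁ v₁ → t :* (u₀ :* v₁) :+ s :* (u₁ :* v₁) := (t :* u₀ :+ s :* u₁) :* v₁) refl s t (u 0F) (u 1F) (v' 1F))
        (trans (cong (_* v' 1F) D≡0) (zeroˡ _)))

    private
      swap : ∀ a b x → a * (b * x) ≡ b * (a * x)
      swap = solve 3 (λ a b x → a :* (b :* x) := b :* (a :* x)) refl

      second-row : ∀ X → t * X 0F + s * X 3F ≡ 0# → t * X 2F + s * X 1F ≡ 0# → ∃ λ v → X ≐ φ (pair s t) v
      second-row X e₀ e₁ with s ≟ 0#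
      ... | no s≢0 = pair (i * X 0F) (i * X 2F) , λ
        { 0F → unit (X 0F)
        ; 1F → trans (unit (X 1F)) (trans (swap s i (X 1F)) (trans (cong (i *_) (sym (x+y≡0⇒x≡y e₁))) (swap i t (X 2F))))
        ; 2F → unit (X 2F)
        ; 3F → trans (unit (X 3F)) (trans (swap s i (X 3F)) (trans (cong (i *_) (sym (x+y≡0⇒x≡y e₀)))
                 (trans (swap i t (X 0F)) (sym (-x≡x _))))) }
        where
        i = proj₁ (inverse s s≢0)
        unit : ∀ x → x ≡ s * (i * x)
        unit x = trans (sym (*-identityˡ x)) (trans (cong (_* x) (sym (proj₂ (inverse s s≢0)))) (*-assoc s i x))
      ... | yes s≡0 = pair (j * X 3F) (j * X 1F) , λ
        { 0F → trans (unit (X 0F)) (trans (swap t j (X 0F)) (trans (cong (j *_) (x+y≡0⇒x≡y e₀)) (swap j s (X 3F))))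
        ; 1F → unit (X 1F)
        ; 2F → trans (unit (X 2F)) (trans (swap t j (X 2F)) (trans (cong (j *_) (x+y≡0⇒x≡y e₁)) (swap j s (X 1F))))
        ; 3F → trans (unit (X 3F)) (sym (-x≡x _)) }
        where
        t≢0 : t ≢ 0#
        t≢0 = st≢0 s≡0
        j = proj₁ (inverse t t≢0)
        unit : ∀ x → x ≡ t * (j * x)
        unit x = trans (sym (*-identityˡ x)) (trans (cong (_* x) (sym (proj₂ (inverse t t≢0)))) (*-assoc t j x))

    rulingˡ⇐ : ∀ {W X} → W ≐ conicPt c s t →
               t * X 0F + s * X 3F ≡ 0# → t * X 2F + s * X 1F ≡ 0# → Rulingˡ W X
    rulingˡ⇐ {W} {X} W≐ e₀ e₁ =
      pair s t , (λ z → st≢0 (z 0F) (z 1F)) , pair (c * s) (c * t) , proj₁ row ,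
      (λ i → trans (W≐ i) (at-infinity i)) , proj₂ row
      where
      row = second-row X e₀ e₁
      at-infinity : conicPt c s t ≐ φ (pair s t) (pair (c * s) (c * t))
      at-infinity 0F = solve 2 (λ c s → c :* (s :* s) := s :* (c :* s)) refl c s
      at-infinity 1F = solve 2 (λ c s → c :* (s :* s) := s :* (c :* s)) refl c t
      at-infinity 2F = solve 3 (λ c s t → c :* (s :* t) := s :* (c :* t)) refl c s t
      at-infinity 3F = solve 3 (λ c s t → c :* (s :* t) := :- (t :* (c :* s))) refl c s t

    -- Transposing the 2×2 matrix exchanges the reguli and fixes the points of the conic, so the
    -- second regulus needs no computation of its own.
    transpose : Vec 4 → Vec 4
    transpose X 0F = X 0F
    transpose X 1F = X 1F
    transpose X 2F = X 3F
    transpose X 3F = X 2F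

    φ-transpose : ∀ u v X → X ≐ φ u v → transpose X ≐ φ v u
    φ-transpose u v X eq 0F = trans (eq 0F) (*-comm _ _)
    φ-transpose u v X eq 1F = trans (eq 1F) (*-comm _ _)
    φ-transpose u v X eq 2F = trans (eq 3F) (trans (-x≡x _) (*-comm _ _))
    φ-transpose u v X eq 3F = trans (eq 2F) (trans (*-comm _ _) (sym (-x≡x _)))

    transpose-conicPt : ∀ {W} → W ≐ conicPt c s t → transpose W ≐ conicPt c s t
    transpose-conicPt eq 0F = eq 0F
    transpose-conicPt eq 1F = eq 1F
    transpose-conicPt eq 2F = eq 3F
    transpose-conicPt eq 3F = eq 2F

    rulingʳ⇒ : ∀ {W X} → W ≐ conicPt c s t → Rulingʳ W X →
               t * X 0F + s * X 2F ≡ 0# × t * X 3F + s * X 1F ≡ 0#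
    rulingʳ⇒ {W} {X} W≐ (v , nz , u , u' , W≐φ , X≐φ) = rulingˡ⇒ (transpose-conicPt W≐)
      (v , nz , u , u' , φ-transpose u v W W≐φ , φ-transpose u' v X X≐φ)

    rulingʳ⇐ : ∀ {W X} → W ≐ conicPt c s t →
               t * X 0F + s * X 2F ≡ 0# → t * X 3F + s * X 1F ≡ 0# → Rulingʳ W X
    rulingʳ⇐ {W} {X} W≐ e₀ e₁ with rulingˡ⇐ {X = transpose X} (transpose-conicPt W≐) e₀ e₁
    ... | v , nz , u , u' , W≐φ , X≐φ = v , nz , u , u' , back W≐φ , back X≐φ
      where
      back : ∀ {u Y} → transpose Y ≐ φ v u → Y ≐ φ u v
      back {u} {Y} eq = λ
        { 0F → φ-transpose v u (transpose Y) eq 0F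
        ; 1F → φ-transpose v u (transpose Y) eq 1F
        ; 2F → φ-transpose v u (transpose Y) eq 2F
        ; 3F → φ-transpose v u (transpose Y) eq 3F }

  module Quadric {C : TernaryForm} (F : Frame C) (α β γ δ : Carrier) (α+δ≢0 : α + δ ≢ 0#) where
    open Frame F

    private
      ι : Carrier
      ι = proj₁ (inverse (α + δ) α+δ≢0)

      ι-inverse : (α + δ) * ι ≡ 1#
      ι-inverse = proj₂ (inverse (α + δ) α+δ≢0)

    tail : Vec 4 → Vec 3
    tail v i = v (suc i)

    -- On affine points the rows are x + β, z + γ, y + δ and y + α in frame coordinates. At infinity
    -- `hyp` becomes xz + y², the conic up to the factor `μ`.
    M : Mat4
    M 0F 0F      = β
    M 0F (suc j) = T 0F j
    M 1F 0F      = γ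
    M 1F (suc j) = T 2F j
    M 2F 0F      = δ
    M 2F (suc j) = T 1F j
    M 3F 0F      = α
    M 3F (suc j) = T 1F j

    offset : Fin 4 → Carrier
    offset i = M i 0F

    row : Fin 4 → Fin 3
    row 0F = 0F
    row 1F = 2F
    row 2F = 1F
    row 3F = 1F

    apply-M : ∀ v i → apply M v i ≡ offset i * v 0F + mul T (tail v) (row i)
    apply-M v = λ { 0F → assoc _ _ _ _ ; 1F → assoc _ _ _ _ ; 2F → assoc _ _ _ _ ; 3F → assoc _ _ _ _ }
      where
      assoc : ∀ a b c d → a + b + c + d ≡ a + (b + c + d)
      assoc = solve 4 (λ a b c d → a :+ b :+ c :+ d := a :+ (b :+ c :+ d)) refl

    private
      -- Rows 2 and 3 of `M` add up to (α + δ) times the homogenising coordinate, which `height`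
      -- thus recovers. `N` removes the offsets by means of it and applies `U`; `κ` collects the
      -- resulting contribution of `height`.
      κ : Fin 3 → Carrier
      κ r = (U r 0F * β + U r 1F * δ + U r 2F * γ) * ι

      N : Mat4
      N 0F 0F      = 0#
      N 0F 1F      = 0#
      N 0F 2F      = ι
      N 0F 3F      = ι
      N (suc r) 0F = U r 0F
      N (suc r) 1F = U r 2F
      N (suc r) 2F = U r 1F + κ r
      N (suc r) 3F = κ r

      height : Vec 4 → Carrier
      height X = ι * (X 2F + X 3F)

      coords : Vec 4 → Vec 3
      coords X 0F = X 0F + β * height X
      coords X 1F = X 2F + δ * height X
      coords X 2F = X 1F + γ * height X

      apply-N-0 : ∀ X → apply N X 0F ≡ height X
      apply-N-0 X = solve 5 (λ i a b c d →
        con false :* a :+ con false :* b :+ i :* c :+ i :* d := i :* (c :+ d)) refl ι (X 0F) (X 1F) (X 2F) (X 3F)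

      apply-N-suc : ∀ X r → apply N X (suc r) ≡ mul U (coords X) r
      apply-N-suc X r = solve 11 (λ x y z i β γ δ a b c d →
        x :* a :+ z :* b :+ (y :+ (x :* β :+ y :* δ :+ z :* γ) :* i) :* c :+ ((x :* β :+ y :* δ :+ z :* γ) :* i) :* d
        := x :* (a :+ β :* (i :* (c :+ d))) :+ y :* (c :+ δ :* (i :* (c :+ d))) :+ z :* (b :+ γ :* (i :* (c :+ d))))
        refl (U r 0F) (U r 1F) (U r 2F) ι β γ δ (X 0F) (X 1F) (X 2F) (X 3F)

      cancel : ∀ a b → (a + b) + a ≡ b
      cancel = solve 2 (λ a b → (a :+ b) :+ a := b) refl

      cancelʳ : ∀ a b → a + (b + a) ≡ b
      cancelʳ = solve 2 (λ a b → a :+ (b :+ a) := b) refl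

      height-M : ∀ v → height (apply M v) ≡ v 0F
      height-M v = begin
        ι * (apply M v 2F + apply M v 3F)                ≡⟨ cong (ι *_) (cong₂ _+_ (apply-M v 2F) (apply-M v 3F)) ⟩
        ι * ((δ * v 0F + y) + (α * v 0F + y))            ≡⟨ solve 5 (λ i α δ v y →
          i :* ((δ :* v :+ y) :+ (α :* v :+ y)) := ((α :+ δ) :* i) :* v) refl ι α δ (v 0F) y ⟩
        ((α + δ) * ι) * v 0F                             ≡⟨ cong (_* v 0F) ι-inverse ⟩
        1# * v 0F                                        ≡⟨ *-identityˡ _ ⟩
        v 0F                                             ∎
        where
        open ≡-Reasoning
        y = mul T (tail v) 1F

      coords-M : ∀ v → coords (apply M v) ≐ mul T (tail v)
      coords-M v = λ
        { 0F → trans (cong₂ (λ a b → a + β * b) (apply-M v 0F) (height-M v)) (cancel _ _)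
        ; 1F → trans (cong₂ (λ a b → a + δ * b) (apply-M v 2F) (height-M v)) (cancel _ _)
        ; 2F → trans (cong₂ (λ a b → a + γ * b) (apply-M v 1F) (height-M v)) (cancel _ _) }

      NM : ∀ v → apply N (apply M v) ≐ v
      NM v 0F      = trans (apply-N-0 (apply M v)) (height-M v)
      NM v (suc r) = trans (apply-N-suc (apply M v) r) (trans (mul-cong U (coords-M v) r) (UT (tail v) r))

      T-N : ∀ X → mul T (tail (apply N X)) ≐ coords X
      T-N X i = trans (mul-cong T (apply-N-suc X) i) (TU (coords X) i)

      M-N : ∀ X i → apply M (apply N X) i ≡ offset i * height X + coords X (row i)
      M-N X i = trans (apply-M (apply N X) i) (cong₂ _+_ (cong (offset i *_) (apply-N-0 X)) (T-N X (row i)))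

      MN : ∀ X → apply M (apply N X) ≐ X
      MN X = λ
        { 0F → trans (M-N X 0F) (cancelʳ _ _)
        ; 1F → trans (M-N X 1F) (cancelʳ _ _)
        ; 2F → trans (M-N X 2F) (cancelʳ _ _)
        ; 3F → trans (M-N X 3F) (begin
            α * (ι * (X 2F + X 3F)) + (X 2F + δ * (ι * (X 2F + X 3F)))
              ≡⟨ solve 5 (λ i α δ c d → α :* (i :* (c :+ d)) :+ (c :+ δ :* (i :* (c :+ d)))
                   := ((α :+ δ) :* i) :* (c :+ d) :+ c) refl ι α δ (X 2F) (X 3F) ⟩
            ((α + δ) * ι) * (X 2F + X 3F) + X 2F
              ≡⟨ cong (λ r → r * (X 2F + X 3F) + X 2F) ι-inverse ⟩
            1# * (X 2F + X 3F) + X 2F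
              ≡⟨ solve 2 (λ c d → con true :* (c :+ d) :+ c := d) refl (X 2F) (X 3F) ⟩
            X 3F ∎) }
        where open ≡-Reasoning

    invertible : Invertible M
    invertible = N , λ v → NM v , MN v

    apply-atInfinity : ∀ d i → apply M (atInfinity d) i ≡ mul T d (row i)
    apply-atInfinity d i = trans (apply-M (atInfinity d) i)
      (trans (cong (_+ mul T d (row i)) (zeroʳ (offset i))) (+-identityˡ _))

    apply-affine : ∀ x i → apply M (affinePt x) i ≡ offset i + mul T x (row i)
    apply-affine x i = trans (apply-M (affinePt x) i) (cong (_+ mul T x (row i)) (*-identityʳ (offset i)))

    hyp-atInfinity : ∀ d → form C d ≡ μ * hyp (apply M (atInfinity d))
    hyp-atInfinity d = trans (form-T d) (cong (μ *_) (sym (cong₂ _+_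
      (cong₂ _*_ (apply-atInfinity d 0F) (apply-atInfinity d 1F))
      (cong₂ _*_ (apply-atInfinity d 2F) (apply-atInfinity d 3F)))))

    conic-at-infinity : ∀ d → hyp (apply M (atInfinity d)) ≡ 0# ⇔ form C d ≡ 0#
    conic-at-infinity d = mk⇔
      (λ e → trans (hyp-atInfinity d) (trans (cong (μ *_) e) (zeroʳ μ)))
      (λ e → no-zero-divisors (trans (sym (hyp-atInfinity d)) e) μ≢0)

-- Lines with directions on the conic as points of W(q).

module KakeyaLines {q : ℕ} (𝔽 : FiniteField q) (h : ℕ) (q≡ : q ≡ 2 ^ suc h) where
  open Geom 𝔽
  open CharacteristicTwo 𝔽 h q≡
  open ConicFrames 𝔽 h q≡
  open Reguli 𝔽 h q≡
  open CommutativeRing commutativeRing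
    using (+-identityˡ; *-assoc; *-comm; *-identityˡ; zeroˡ; zeroʳ)
  open Inverse enumeration using (to; from; strictlyInverseˡ; strictlyInverseʳ)

  ∝-refl : ∀ {n} {u : Vec n} → u ∝ u
  ∝-refl {u = u} = 1# , (λ e → 0≢1 (sym e)) , λ i → sym (*-identityˡ (u i))

  ∝-sym : ∀ {n} {u v : Vec n} → u ∝ v → v ∝ u
  ∝-sym {u = u} {v} (c , c≢0 , eq) = i , i≢0 , λ k → trans (sym (*-identityˡ (v k)))
    (trans (cong (_* v k) (trans (sym ci) (*-comm c i))) (trans (*-assoc i c (v k)) (cong (i *_) (sym (eq k)))))
    where
    i = proj₁ (inverse c c≢0)
    ci = proj₂ (inverse c c≢0)
    i≢0 : i ≢ 0#
    i≢0 e = 0≢1 (trans (sym (zeroʳ c)) (trans (cong (c *_) (sym e)) ci))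

  ∝-trans : ∀ {n} {u v w : Vec n} → u ∝ v → v ∝ w → u ∝ w
  ∝-trans {w = w} (c , c≢0 , e) (c' , c'≢0 , e') =
    c * c' , *-nonzero c≢0 c'≢0 , λ k → trans (e k) (trans (cong (c *_) (e' k)) (sym (*-assoc c c' (w k))))

  mul-line : ∀ M {p b d : Vec 3} r → (∀ i → p i ≡ b i + r * d i) → ∀ i → mul M p i ≡ mul M b i + r * mul M d i
  mul-line M {p} {b} {d} r eq i = trans (mul-cong M eq i)
    (solve 10 (λ x y z b₀ b₁ b₂ r d₀ d₁ d₂ →
      x :* (b₀ :+ r :* d₀) :+ y :* (b₁ :+ r :* d₁) :+ z :* (b₂ :+ r :* d₂)
      := (x :* b₀ :+ y :* b₁ :+ z :* b₂) :+ r :* (x :* d₀ :+ y :* d₁ :+ z :* d₂))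
      refl (M i 0F) (M i 1F) (M i 2F) (b 0F) (b 1F) (b 2F) r (d 0F) (d 1F) (d 2F))

  mul-scale : ∀ M {p d : Vec 3} r → (∀ i → p i ≡ r * d i) → ∀ i → mul M p i ≡ r * mul M d i
  mul-scale M {p} {d} r eq i = trans (mul-cong M eq i)
    (solve 7 (λ x y z r d₀ d₁ d₂ →
      x :* (r :* d₀) :+ y :* (r :* d₁) :+ z :* (r :* d₂) := r :* (x :* d₀ :+ y :* d₁ :+ z :* d₂))
      refl (M i 0F) (M i 1F) (M i 2F) r (d 0F) (d 1F) (d 2F))

  module Conic {C : TernaryForm} (F : Frame C) where
    open Frame F

    T-injective : ∀ {u v} → mul T u ≐ mul T v → u ≐ v
    T-injective {u} {v} eq i = trans (sym (UT u i)) (trans (mul-cong U eq i) (UT v i))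

    -- Normalised coordinates on the projective line: (0 : 1) and the points (1 : x). The Veronese
    -- map carries them onto the conic.
    s t : Fin (suc q) → Carrier
    s zero    = 0#
    s (suc i) = 1#
    t zero    = 1#
    t (suc i) = to i

    st≢0 : ∀ i → s i ≡ 0# → t i ≡ 0# → ⊥
    st≢0 zero    _ e = 0≢1 (sym e)
    st≢0 (suc i) e _ = 0≢1 (sym e)

    det : Fin (suc q) → Fin (suc q) → Carrier
    det i j = s i * t j + t i * s j

    det≢0 : ∀ {i j} → i ≢ j → det i j ≢ 0#
    det≢0 {zero}  {zero}  ne _ = ne refl
    det≢0 {zero}  {suc j} ne e = 0≢1 (trans (sym e) (solve 1 (λ x → con false :* x :+ con true :* con true := con true) refl (to j)))
    det≢0 {suc i} {zero}  ne e = 0≢1 (trans (sym e) (solve 1 (λ x → con true :* con true :+ x :* con false := con true) refl (to i)))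
    det≢0 {suc i} {suc j} ne e = ne (cong suc (trans (sym (strictlyInverseʳ i)) (trans (cong from to-eq) (strictlyInverseʳ j))))
      where
      to-eq : to i ≡ to j
      to-eq = x+y≡0⇒x≡y (trans (solve 2 (λ x y → x :+ y := con true :* y :+ x :* con true) refl (to i) (to j)) e)

    veronese : Carrier → Carrier → Vec 3
    veronese a b 0F = a * a
    veronese a b 1F = a * b
    veronese a b 2F = b * b

    direction : Fin (suc q) → Vec 3
    direction i = mul U (veronese (s i) (t i))

    T-direction : ∀ i → mul T (direction i) ≐ veronese (s i) (t i)
    T-direction i = TU (veronese (s i) (t i))

    ∝-direction : ∀ {d} i c → (∀ k → d k ≡ c * direction i k) → ∀ k → mul T d k ≡ c * veronese (s i) (t i) k
    ∝-direction i c eq k = trans (mul-scale T c eq k) (cong (c *_) (T-direction i k))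

    mul-zero : ∀ M {v : Vec 3} → (∀ i → v i ≡ 0#) → ∀ i → mul M v i ≡ 0#
    mul-zero M z i = trans (mul-cong M z i)
      (solve 3 (λ x y z → x :* con false :+ y :* con false :+ z :* con false := con false) refl (M i 0F) (M i 1F) (M i 2F))

    onConic : ∀ {d} i → d ∝ direction i → OnConic C d
    onConic {d} i (c , c≢0 , eq) =
      (λ z → st≢0 i (square≡0 (no-zero-divisors (trans (sym (Td 0F)) (mul-zero T z 0F)) c≢0))
                    (square≡0 (no-zero-divisors (trans (sym (Td 2F)) (mul-zero T z 2F)) c≢0))) ,
      trans (form-T d) (trans
        (cong₂ (λ p r → μ * (p + r)) (cong₂ _*_ (Td 0F) (Td 2F)) (cong₂ _*_ (Td 1F) (Td 1F)))
        (solve 4 (λ μ c s t → μ :* ((c :* (s :* s)) :* (c :* (t :* t)) :+ (c :* (s :* t)) :* (c :* (s :* t))) := con false)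
          refl μ c (s i) (t i)))
      where
      Td = ∝-direction i c eq

    parameter : ∀ d → OnConic C d → ∃ λ i → d ∝ direction i
    parameter d (nz , fd) with mul T d 0F ≟ 0#
    ... | yes x≡0 = zero , mul T d 2F , z≢0 , T-injective {d} λ k →
            trans (Td k) (sym (trans (mul-scale T {d = direction zero} (mul T d 2F) (λ _ → refl) k) (cong (mul T d 2F *_) (T-direction zero k))))
      where
      y≡0 : mul T d 1F ≡ 0#
      y≡0 = square≡0 (begin
        mul T d 1F * mul T d 1F                            ≡⟨ +-identityˡ _ ⟨
        0# + mul T d 1F * mul T d 1F                       ≡⟨ cong (_+ mul T d 1F * mul T d 1F) (trans (cong (_* mul T d 2F) x≡0) (zeroˡ _)) ⟨
        mul T d 0F * mul T d 2F + mul T d 1F * mul T d 1F  ≡⟨ no-zero-divisors (trans (sym (form-T d)) fd) μ≢0 ⟩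
        0#                                                 ∎)
        where open ≡-Reasoning
      z≢0 : mul T d 2F ≢ 0#
      z≢0 z≡0 = nz (λ i → trans (sym (UT d i)) (mul-zero U {mul T d} (λ { 0F → x≡0 ; 1F → y≡0 ; 2F → z≡0 }) i))
      Td : ∀ k → mul T d k ≡ mul T d 2F * veronese 0# 1# k
      Td 0F = trans x≡0 (solve 1 (λ z → con false := z :* (con false :* con false)) refl (mul T d 2F))
      Td 1F = trans y≡0 (solve 1 (λ z → con false := z :* (con false :* con true)) refl (mul T d 2F))
      Td 2F = solve 1 (λ z → z := z :* (con true :* con true)) refl (mul T d 2F)
    ... | no x≢0 = suc (from w) , x , x≢0 , T-injective {d} λ k →
            trans (Td k) (sym (trans (mul-scale T {d = direction (suc (from w))} x (λ _ → refl) k) (cong (x *_) (T-direction (suc (from w)) k))))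
      where
      x = mul T d 0F
      y = mul T d 1F
      z = mul T d 2F
      w = proj₁ (quotient y x≢0)
      xw : x * to (from w) ≡ y
      xw = trans (cong (x *_) (strictlyInverseˡ w)) (proj₂ (quotient y x≢0))
      z≡ : z ≡ x * (to (from w) * to (from w))
      z≡ = x+y≡0⇒x≡y (no-zero-divisors (begin
        x * (z + x * (to (from w) * to (from w)))
          ≡⟨ solve 3 (λ x z w → x :* (z :+ x :* (w :* w)) := x :* z :+ (x :* w) :* (x :* w)) refl x z (to (from w)) ⟩
        x * z + (x * to (from w)) * (x * to (from w))
          ≡⟨ cong (λ v → x * z + v * v) xw ⟩
        x * z + y * y
          ≡⟨ no-zero-divisors (trans (sym (form-T d)) fd) μ≢0 ⟩
        0# ∎) x≢0)
        where open ≡-Reasoning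
      Td : ∀ k → mul T d k ≡ x * veronese 1# (to (from w)) k
      Td 0F = solve 1 (λ x → x := x :* (con true :* con true)) refl x
      Td 1F = trans (sym xw) (cong (x *_) (sym (*-identityˡ _)))
      Td 2F = z≡

    parameter-unique : ∀ {d i j} → d ∝ direction i → d ∝ direction j → i ≡ j
    parameter-unique {d} {i} {j} (c , c≢0 , e) (c' , _ , e') with i Fin.≟ j
    ... | yes eq = eq
    ... | no i≢j = contradiction
            -- The forms t_j x + s_j y and t_j y + s_j z vanish at the point with parameter `j`; at
            -- the one with parameter `i` they take the values s_i det and t_i det.
            (kill (s i) (trans
              (solve 5 (λ c s t s' t' → c :* (s :* (s :* t' :+ t :* s')) := t' :* (c :* (s :* s)) :+ s' :* (c :* (s :* t))) refl c (s i) (t i) (s j) (t j))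
              (trans (cong₂ (λ a b → t j * a + s j * b) (same 0F) (same 1F))
                (solve 3 (λ c s t → t :* (c :* (s :* s)) :+ s :* (c :* (s :* t)) := con false) refl c' (s j) (t j)))))
            (λ s≡0 → st≢0 i s≡0 (kill (t i) (trans
              (solve 5 (λ c s t s' t' → c :* (t :* (s :* t' :+ t :* s')) := t' :* (c :* (s :* t)) :+ s' :* (c :* (t :* t))) refl c (s i) (t i) (s j) (t j))
              (trans (cong₂ (λ a b → t j * a + s j * b) (same 1F) (same 2F))
                (solve 3 (λ c s t → t :* (c :* (s :* t)) :+ s :* (c :* (t :* t)) := con false) refl c' (s j) (t j))))))
      where
      same : ∀ k → c * veronese (s i) (t i) k ≡ c' * veronese (s j) (t j) k
      same k = trans (sym (∝-direction i c e k)) (∝-direction j c' e' k)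
      kill : ∀ x → c * (x * det i j) ≡ 0# → x ≡ 0#
      kill x eq = no-zero-divisors (trans (*-comm _ _) (no-zero-divisors eq c≢0)) (det≢0 i≢j)

  module Lines
    {C : TernaryForm} (F : Frame C)
    (b : Fin (suc q) → Vec 3) (d : Fin (suc q) → Vec 3) (d∝ : ∀ i → d i ∝ Conic.direction F i)
    where
    open Frame F
    open Conic F

    private
      I : Set
      I = Fin (suc q)

    m k : I → Carrier
    m i = t i * mul T (b i) 0F + s i * mul T (b i) 1F
    k i = t i * mul T (b i) 1F + s i * mul T (b i) 2F

    -- The line b i + ⟨d i⟩ as an intersection of two planes; (s i, t i, m i, k i)
    -- is the point of the symplectic quadrangle W(q) representing it.
    On : Vec 3 → I → Set
    On p i = (t i * mul T p 0F + s i * mul T p 1F ≡ m i) × (t i * mul T p 1F + s i * mul T p 2F ≡ k i)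

    On? : ∀ p i → Dec (On p i)
    On? p i = (_ ≟ _) ×-dec (_ ≟ _)

    On-cong : ∀ {p p' i} → mul T p ≐ mul T p' → On p i → On p' i
    On-cong {i = i} eq (e₁ , e₂) =
      trans (cong₂ (λ x y → t i * x + s i * y) (sym (eq 0F)) (sym (eq 1F))) e₁ ,
      trans (cong₂ (λ x y → t i * x + s i * y) (sym (eq 1F)) (sym (eq 2F))) e₂

    private
      c : I → Carrier
      c i = proj₁ (d∝ i)

      Td : ∀ i a → mul T (d i) a ≡ c i * veronese (s i) (t i) a
      Td i = ∝-direction i (c i) (proj₂ (proj₂ (d∝ i)))

    onLine⇒On : ∀ {p i} → OnLine p (line (b i) (d i)) → On p i
    onLine⇒On {p} {i} (r , eq) =
      trans (cong₂ (λ x y → t i * x + s i * y) (Tp 0F) (Tp 1F))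
        (solve 6 (λ s t x y r c → t :* (x :+ r :* (c :* (s :* s))) :+ s :* (y :+ r :* (c :* (s :* t))) := t :* x :+ s :* y)
          refl (s i) (t i) (mul T (b i) 0F) (mul T (b i) 1F) r (c i)) ,
      trans (cong₂ (λ x y → t i * x + s i * y) (Tp 1F) (Tp 2F))
        (solve 6 (λ s t x y r c → t :* (x :+ r :* (c :* (s :* t))) :+ s :* (y :+ r :* (c :* (t :* t))) := t :* x :+ s :* y)
          refl (s i) (t i) (mul T (b i) 1F) (mul T (b i) 2F) r (c i))
      where
      Tp : ∀ a → mul T p a ≡ mul T (b i) a + r * (c i * veronese (s i) (t i) a)
      Tp a = trans (mul-line T r eq a) (cong (λ x → mul T (b i) a + r * x) (Td i a))

    private
      multiple : ∀ i (x y z : Carrier) → t i * x + s i * y ≡ 0# → t i * y + s i * z ≡ 0# →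
                 ∃ λ r → x ≡ r * (s i * s i) × y ≡ r * (s i * t i) × z ≡ r * (t i * t i)
      multiple zero x y z e₁ e₂ = z ,
        trans (solve 2 (λ x y → x := con true :* x :+ con false :* y) refl x y)
          (trans e₁ (solve 1 (λ z → con false := z :* (con false :* con false)) refl z)) ,
        trans (solve 2 (λ x y → x := con true :* x :+ con false :* y) refl y z)
          (trans e₂ (solve 1 (λ z → con false := z :* (con false :* con true)) refl z)) ,
        solve 1 (λ z → z := z :* (con true :* con true)) refl z
      multiple (suc i) x y z e₁ e₂ = x ,
        solve 1 (λ z → z := z :* (con true :* con true)) refl x ,
        trans y≡ (solve 2 (λ t x → t :* x := x :* (con true :* t)) refl (to i) x) ,
        trans (trans (sym (*-identityˡ z)) (sym (x+y≡0⇒x≡y e₂)))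
          (trans (cong (to i *_) y≡) (solve 2 (λ t x → t :* (t :* x) := x :* (t :* t)) refl (to i) x))
        where
        y≡ : y ≡ to i * x
        y≡ = trans (sym (*-identityˡ y)) (sym (x+y≡0⇒x≡y e₁))

    -- The difference of `p` and the base point solves both homogeneous equations, so it is a
    -- `multiple` of (s², st, t²). Dividing by `c i` expresses it by the direction `d i`.
    On⇒onLine : ∀ {p i} → On p i → OnLine p (line (b i) (d i))
    On⇒onLine {p} {i} (e₁ , e₂) = r / c' , T-injective {p} λ a → begin
        mul T p a                                               ≡⟨ solve 2 (λ x y → x := y :+ (x :+ y)) refl (mul T p a) (mul T (b i) a) ⟩
        mul T (b i) a + (mul T p a + mul T (b i) a)             ≡⟨ cong (mul T (b i) a +_) (diff a) ⟩
        mul T (b i) a + r * veronese (s i) (t i) a              ≡⟨ cong (λ x → mul T (b i) a + x * veronese (s i) (t i) a) (sym (r/c r)) ⟩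
        mul T (b i) a + (c i * (r / c')) * veronese (s i) (t i) a
          ≡⟨ cong (mul T (b i) a +_) (solve 3 (λ x y z → (x :* y) :* z := y :* (x :* z)) refl (c i) (r / c') _) ⟩
        mul T (b i) a + (r / c') * (c i * veronese (s i) (t i) a)
          ≡⟨ cong (λ x → mul T (b i) a + (r / c') * x) (Td i a) ⟨
        mul T (b i) a + (r / c') * mul T (d i) a                ≡⟨ mul-line T {b = b i} {d = d i} (r / c') (λ _ → refl) a ⟨
        mul T (λ j → b i j + (r / c') * d i j) a                ∎
      where
      open ≡-Reasoning
      c' : c i ≢ 0#
      c' = proj₁ (proj₂ (d∝ i))
      _/_ : Carrier → c i ≢ 0# → Carrier
      x / ne = proj₁ (quotient x ne)
      r/c : ∀ x → c i * (x / c') ≡ x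
      r/c x = proj₂ (quotient x c')
      regroup : ∀ s t x y x' y' → t * x + s * y ≡ t * x' + s * y' → t * (x + x') + s * (y + y') ≡ 0#
      regroup s t x y x' y' e = trans
        (solve 6 (λ s t x y x' y' → t :* (x :+ x') :+ s :* (y :+ y') := (t :* x :+ s :* y) :+ (t :* x' :+ s :* y')) refl s t x y x' y')
        (x≡y⇒x+y≡0 e)
      found = multiple i (mul T p 0F + mul T (b i) 0F) (mul T p 1F + mul T (b i) 1F) (mul T p 2F + mul T (b i) 2F)
                (regroup _ _ _ _ _ _ e₁) (regroup _ _ _ _ _ _ e₂)
      r = proj₁ found
      diff : ∀ a → mul T p a + mul T (b i) a ≡ r * veronese (s i) (t i) a
      diff 0F = proj₁ (proj₂ found)
      diff 1F = proj₁ (proj₂ (proj₂ found))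
      diff 2F = proj₂ (proj₂ (proj₂ found))

    -- The difference of two common points satisfies a 2×2 system with determinant `det i j` in its
    -- first two coordinates, and another one in its last two.
    same-point : ∀ {i j p p'} → i ≢ j → On p i → On p j → On p' i → On p' j → mul T p ≐ mul T p'
    same-point {i} {j} {p} {p'} i≢j (a₁ , a₂) (b₁ , b₂) (a₁' , a₂') (b₁' , b₂') = λ
      { 0F → x+y≡0⇒x≡y (proj₁ xy) ; 1F → x+y≡0⇒x≡y (proj₂ xy) ; 2F → x+y≡0⇒x≡y (proj₂ yz) }
      where
      difference : ∀ l {x y x' y' v} → t l * x + s l * y ≡ v → t l * x' + s l * y' ≡ v →
                   t l * (x + x') + s l * (y + y') ≡ 0#
      difference l {x} {y} {x'} {y'} e e' = trans
        (solve 6 (λ s t x y x' y' → t :* (x :+ x') :+ s :* (y :+ y') := (t :* x :+ s :* y) :+ (t :* x' :+ s :* y')) refl (s l) (t l) x y x' y')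
        (x≡y⇒x+y≡0 (trans e (sym e')))
      xy = cramer (det≢0 i≢j) (difference i a₁ a₁') (difference j b₁ b₁')
      yz = cramer (det≢0 i≢j) (difference i a₂ a₂') (difference j b₂ b₂')

    -- The symplectic form of W(q) at the points (s, t, m, k) of the lines `i` and `j`.
    pairing : I → I → Carrier
    pairing i j = t j * m i + s j * k i + (t i * m j + s i * k j)

    meet⇒pairing : ∀ {i j p} → On p i → On p j → pairing i j ≡ 0#
    meet⇒pairing {i} {j} {p} (a₁ , a₂) (b₁ , b₂) = trans
      (sym (cong₂ _+_ (cong₂ (λ x y → t j * x + s j * y) a₁ a₂) (cong₂ (λ x y → t i * x + s i * y) b₁ b₂)))
      (solve 7 (λ s t s' t' x y z →
        t' :* (t :* x :+ s :* y) :+ s' :* (t :* y :+ s :* z) :+ (t :* (t' :* x :+ s' :* y) :+ s :* (t' :* y :+ s' :* z))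
        := con false) refl (s i) (t i) (s j) (t j) (mul T p 0F) (mul T p 1F) (mul T p 2F))

    -- In W(q), the points collinear with both i and j lie on the polar of the line ij.
    collinear-with-two : ∀ {i j l α β γ δ} → i ≢ j →
      m i ≡ α * s i + β * t i → k i ≡ γ * s i + δ * t i →
      m j ≡ α * s j + β * t j → k j ≡ γ * s j + δ * t j →
      pairing i l ≡ 0# → pairing j l ≡ 0# →
      m l ≡ δ * s l + β * t l × k l ≡ γ * s l + α * t l
    collinear-with-two {i} {j} {l} {α} {β} {γ} {δ} i≢j mi ki mj kj pil pjl =
      x+y≡0⇒x≡y (proj₁ solution) , x+y≡0⇒x≡y (proj₂ solution)
      where
      equation : ∀ n → m n ≡ α * s n + β * t n → k n ≡ γ * s n + δ * t n → pairing n l ≡ 0# →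
                 t n * (m l + (δ * s l + β * t l)) + s n * (k l + (γ * s l + α * t l)) ≡ 0#
      equation n mn kn pnl = trans
        (solve 10 (λ α β γ δ s t s' t' m' k' →
          t :* (m' :+ (δ :* s' :+ β :* t')) :+ s :* (k' :+ (γ :* s' :+ α :* t'))
          := t' :* (α :* s :+ β :* t) :+ s' :* (γ :* s :+ δ :* t) :+ (t :* m' :+ s :* k'))
          refl α β γ δ (s n) (t n) (s l) (t l) (m l) (k l))
        (trans (cong₂ (λ x y → t l * x + s l * y + (t n * m l + s n * k l)) (sym mn) (sym kn)) pnl)
      solution = cramer (det≢0 i≢j) (equation i mi ki pil) (equation j mj kj pjl)

    -- The two defects of `p` in the plane equations of `l` satisfy one linear equation for `i` and
    -- one for `j`, because both lines pair to zero with `l`. The determinant `det i j` is nonzero,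
    -- so both defects vanish.
    concurrent : ∀ {i j l p r u} → i ≢ j → j ≢ l → i ≢ l →
      On p i → On p j → On r j → On r l → On u i → On u l → On p l
    concurrent {i} {j} {l} {p} {r} {u} i≢j j≢l i≢l pi pj rj rl ui ul =
      x+y≡0⇒x≡y (proj₁ solution) , x+y≡0⇒x≡y (proj₂ solution)
      where
      x = mul T p 0F
      y = mul T p 1F
      z = mul T p 2F
      equation : ∀ n → On p n → pairing n l ≡ 0# →
        t n * ((t l * x + s l * y) + m l) + s n * ((t l * y + s l * z) + k l) ≡ 0#
      equation n (e₁ , e₂) pnl = trans
        (solve 9 (λ s t s' t' x y z m' k' →
          t :* ((t' :* x :+ s' :* y) :+ m') :+ s :* ((t' :* y :+ s' :* z) :+ k')
          := t' :* (t :* x :+ s :* y) :+ s' :* (t :* y :+ s :* z) :+ (t :* m' :+ s :* k'))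
          refl (s n) (t n) (s l) (t l) x y z (m l) (k l))
        (trans (cong₂ (λ a a' → t l * a + s l * a' + (t n * m l + s n * k l)) e₁ e₂) pnl)
      solution = cramer (det≢0 i≢j) (equation i pi (meet⇒pairing {p = u} ui ul)) (equation j pj (meet⇒pairing {p = r} rj rl))

    -- Lagrange interpolation of a linear form in (s, t) at two distinct points of the projective
    -- line.
    interpolate : ∀ {i j} (f f' : Carrier) → i ≢ j →
      ∃ λ a → ∃ λ a' → f ≡ a * s i + a' * t i × f' ≡ a * s j + a' * t j
    interpolate {i} {j} f f' i≢j =
      e * (f * t j + f' * t i) , e * (s i * f' + s j * f) ,
      trans (unit f) (solve 7 (λ e f f' s t s' t' → (s :* t' :+ t :* s') :* e :* f
        := e :* (f :* t' :+ f' :* t) :* s :+ e :* (s :* f' :+ s' :* f) :* t) refl e f f' (s i) (t i) (s j) (t j)) ,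
      trans (unit f') (solve 7 (λ e f f' s t s' t' → (s :* t' :+ t :* s') :* e :* f'
        := e :* (f :* t' :+ f' :* t) :* s' :+ e :* (s :* f' :+ s' :* f) :* t') refl e f f' (s i) (t i) (s j) (t j))
      where
      e = proj₁ (inverse (det i j) (det≢0 i≢j))
      unit : ∀ x → x ≡ det i j * e * x
      unit x = trans (sym (*-identityˡ x)) (cong (_* x) (sym (proj₂ (inverse (det i j) (det≢0 i≢j)))))

    point : I → Fin q → Vec 3
    point i u a = b i a + to u * d i a

    point-on : ∀ i u → On (point i u) i
    point-on i u = onLine⇒On (to u , λ _ → refl)

    point-injective : ∀ {i u u'} → point i u ≐ point i u' → u ≡ u'
    point-injective {i} {u} {u'} eq with to u + to u' ≟ 0#
    ... | yes e = trans (sym (strictlyInverseʳ u)) (trans (cong from (x+y≡0⇒x≡y e)) (strictlyInverseʳ u'))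
    ... | no ne = contradiction (λ a → no-zero-divisors (vanish a) ne) (proj₁ (onConic i (d∝ i)))
      where
      vanish : ∀ a → (to u + to u') * d i a ≡ 0#
      vanish a = trans
        (solve 4 (λ x y d b → (x :+ y) :* d := (b :+ x :* d) :+ (b :+ y :* d)) refl (to u) (to u') (d i a) (b i a))
        (x≡y⇒x+y≡0 (eq a))

    point-unique : ∀ {i j u u'} → i ≢ j → On (point i u) j → On (point i u') j → u ≡ u'
    point-unique {i} {j} {u} {u'} i≢j o o' =
      point-injective (T-injective {point i u} {point i u'}
        (same-point {p = point i u} {point i u'} i≢j (point-on i u) o (point-on i u') o'))

    transfer : ∀ {i j l p p'} → i ≢ j → On p i → On p j → On p' i → On p' j → On p l → On p' l
    transfer {p = p} {p'} i≢j pi pj p'i p'j =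
      On-cong {p} {p'} (same-point {p = p} {p'} i≢j pi pj p'i p'j)

-- Fitting a Kakeya line set with few points to two opposite reguli.

module KakeyaFamily {q : ℕ} (𝔽 : FiniteField q) (h : ℕ) (q≡ : q ≡ 2 ^ suc h)
  {C : Geom.TernaryForm 𝔽} (F : ConicFrames.Frame 𝔽 h q≡ C)
  {𝓛 : Geom.AffLine 𝔽 → Set} (isKakeya : Geom.IsKakeyaLineSet 𝔽 C 𝓛)
  (ℓ : Fin (suc q) → Geom.AffLine 𝔽) (ℓ∈𝓛 : ∀ i → 𝓛 (ℓ i))
  (dir-ℓ : ∀ i → Geom._∝_ 𝔽 (Geom.dir (ℓ i)) (KakeyaLines.Conic.direction 𝔽 h q≡ F i))
  where
  open Geom 𝔽
  open CharacteristicTwo 𝔽 h q≡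
  open ConicFrames 𝔽 h q≡ using (mul; mul-cong; module Frame)
  open Reguli 𝔽 h q≡
  open KakeyaLines 𝔽 h q≡
  open Frame F using (T; U; TU)
  open Conic F
  open Lines F (λ i → base (ℓ i)) (λ i → dir (ℓ i)) dir-ℓ

  On⇒Kakeya : ∀ {x} i → On x i → KakeyaSet 𝓛 x
  On⇒Kakeya {x} i o = ℓ i , ℓ∈𝓛 i , On⇒onLine {x} o

  -- A member of 𝓛 may differ as a representation from every chosen `ℓ i`; uniqueness of the line in
  -- each direction still gives it the same points as one of them.
  Kakeya⇒On : ∀ {x} → KakeyaSet 𝓛 x → ∃ λ i → On x i
  Kakeya⇒On {x} (ℓ' , ℓ'∈𝓛 , o) with parameter (dir ℓ') (proj₁ isKakeya ℓ' ℓ'∈𝓛)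
  ... | i , p = i , onLine⇒On (Equivalence.to
          (proj₂ (proj₂ isKakeya) (direction i) ℓ' (ℓ i) (onConic i ∝-refl) ℓ'∈𝓛 (ℓ∈𝓛 i) p (dir-ℓ i) x) o)

  -- m = α s + β t, k = γ s + δ t on one part and, with α and δ
  -- exchanged, on the other: a hyperbolic line of W(q) and its polar.
  record RegulusPair : Set₁ where
    field
      α β γ δ    : Carrier
      α+δ≢0      : α + δ ≢ 0#
      Part Part' : Fin (suc q) → Set
      either     : ∀ i → Part i ⊎ Part' i
      exclusive  : ∀ i → Part i → ¬ Part' i
      on-part    : ∀ i → Part i → m i ≡ α * s i + β * t i × k i ≡ γ * s i + δ * t i
      on-part'   : ∀ i → Part' i → m i ≡ δ * s i + β * t i × k i ≡ γ * s i + α * t i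

  module FitReguli (parts : MeetingParts On) where
    open MeetingParts parts

    meeting : ∀ {x y} → Meet x y → pairing x y ≡ 0#
    meeting {x} {y} (p , px , py) = meet⇒pairing {x} {y} {p} px py

    private
      fit-m = interpolate (m b) (m b') b≢b'
      fit-k = interpolate (k b) (k b') b≢b'

    module _ {α β γ δ : Carrier}
      (mb : m b ≡ δ * s b + β * t b) (mb' : m b' ≡ δ * s b' + β * t b')
      (kb : k b ≡ γ * s b + α * t b) (kb' : k b' ≡ γ * s b' + α * t b')
      where

      on-A : ∀ i → A i → m i ≡ α * s i + β * t i × k i ≡ γ * s i + δ * t i
      on-A i Ai = collinear-with-two b≢b' mb kb mb' kb' (meeting (b-meets i Ai)) (meeting (b'-meets i Ai))

      -- The polar of a polar is the original line. By `on-A` the lines `a` and `a'` span the polar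
      -- of the line through `b` and `b'`, so taking polars again brings all of `B` onto the latter.
      on-B : ∀ i → B i → m i ≡ δ * s i + β * t i × k i ≡ γ * s i + α * t i
      on-B i Bi = collinear-with-two a≢a' (proj₁ (on-A a a∈A)) (proj₂ (on-A a a∈A))
        (proj₁ (on-A a' a'∈A)) (proj₂ (on-A a' a'∈A)) (meeting (a-meets i Bi)) (meeting (a'-meets i Bi))

      -- For α = δ the quadric (x + β)(z + γ) = (y + α)(y + δ) degenerates to a cone with this
      -- vertex, which then lies on all four lines `a`, `a'`, `b`, `b'`.
      apex : Vec 3
      apex 0F = β
      apex 1F = α
      apex 2F = γ

      on-apex : ∀ i {e e'} → m i ≡ e * s i + β * t i → k i ≡ γ * s i + e' * t i → e ≡ α → e' ≡ α → On (mul U apex) i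
      on-apex i em ek refl refl =
        trans (cong₂ (λ x y → t i * x + s i * y) (TU apex 0F) (TU apex 1F)) (trans (swap _ _ _ _) (sym em)) ,
        trans (cong₂ (λ x y → t i * x + s i * y) (TU apex 1F) (TU apex 2F)) (trans (swap _ _ _ _) (sym ek))
        where
        swap : ∀ t s x y → t * x + s * y ≡ y * s + x * t
        swap = solve 4 (λ t s x y → t :* x :+ s :* y := y :* s :+ x :* t) refl

      α+δ≢0 : α + δ ≢ 0#
      α+δ≢0 e = no-common-point {mul U apex}
        (on-apex a (proj₁ (on-A a a∈A)) (proj₂ (on-A a a∈A)) refl δ≡α)
        (on-apex a' (proj₁ (on-A a' a'∈A)) (proj₂ (on-A a' a'∈A)) refl δ≡α)
        (on-apex b mb kb δ≡α refl)
        (on-apex b' mb' kb' δ≡α refl)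
        where
        δ≡α : δ ≡ α
        δ≡α = sym (x+y≡0⇒x≡y e)

    regulusPair : RegulusPair
    regulusPair = record
      { α+δ≢0 = α+δ≢0 mb mb' kb kb'
      ; Part = A ; Part' = B ; either = either ; exclusive = exclusive
      ; on-part = on-A mb mb' kb kb' ; on-part' = on-B mb mb' kb kb' }
      where
      mb  = proj₁ (proj₂ (proj₂ fit-m))
      mb' = proj₂ (proj₂ (proj₂ fit-m))
      kb  = proj₁ (proj₂ (proj₂ fit-k))
      kb' = proj₂ (proj₂ (proj₂ fit-k))

  module _ (xs : List (Vec 3)) (enumerates : Enumerates (KakeyaSet 𝓛) xs)
    (few : 4 ℕ.* length xs ℕ.+ 4 ℕ.< 3 ℕ.* q ℕ.* q ℕ.+ 4 ℕ.* q)
    where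

    private
      listed : ∀ i u → _
      listed i u = Equivalence.to (proj₂ enumerates (point i u)) (On⇒Kakeya {point i u} i (point-on i u))

      position : Fin (suc q) → Fin q → Fin (length xs)
      position i u = index (listed i u)

      same-position : ∀ {i j u u'} → position i u ≡ position j u' → point i u ≐ point j u'
      same-position {i} {j} {u} {u'} eq a = trans (lookup-index (listed i u) a)
        (trans (cong (λ n → lookup xs n a) eq) (sym (lookup-index (listed j u') a)))

      position-on : ∀ {i j u u'} → position i u ≡ position j u' → On (point i u) j
      position-on {i} {j} {u} {u'} eq = On-cong {point j u'} {point i u}
        (mul-cong T (λ a → sym (same-position {i} {j} {u} {u'} eq a))) (point-on j u')

    open FewPoints q (length xs) On On? point point-on
      (λ {i} {j} {u} {u'} → point-unique {i} {j} {u} {u'}) (λ {i} {j} {l} {p} {p'} → transfer {i} {j} {l} {p} {p'})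
      (λ {i} {j} {l} {p} {r} {u} → concurrent {i} {j} {l} {p} {r} {u})
      position (λ {i} {j} {u} {u'} → position-on {i} {j} {u} {u'})
      (λ {i} {u} {u'} eq → point-injective {i} (same-position {i} {i} {u} {u'} eq))
      using (meetingParts)

    regulus-pair : RegulusPair
    regulus-pair = FitReguli.regulusPair (meetingParts few)

  module TwoReguli (parts : RegulusPair) where
    open RegulusPair parts
    open Quadric F α β γ δ α+δ≢0

    𝒜 ℬ : Vec 3 → Set
    𝒜 d = ∃ λ i → Part i × d ∝ direction i
    ℬ d = ∃ λ i → Part' i × d ∝ direction i

    infinity : ∀ {d} i → ((c , _) : d ∝ direction i) → apply M (atInfinity d) ≐ conicPt c (s i) (t i)
    infinity {d} i (c , _ , eq) = λ
      { 0F → trans (apply-atInfinity d 0F) (∝-direction i c eq 0F)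
      ; 1F → trans (apply-atInfinity d 1F) (∝-direction i c eq 2F)
      ; 2F → trans (apply-atInfinity d 2F) (∝-direction i c eq 1F)
      ; 3F → trans (apply-atInfinity d 3F) (∝-direction i c eq 1F) }

    private
      shift : ∀ s t x y a b → t * (b + x) + s * (a + y) ≡ (t * x + s * y) + (a * s + b * t)
      shift = solve 6 (λ s t x y a b → t :* (b :+ x) :+ s :* (a :+ y) := (t :* x :+ s :* y) :+ (a :* s :+ b :* t)) refl

      -- A regulus equation in the coordinates given by `M` is a plane equation of line `i` in frame
      -- coordinates, provided that the constant `n` is the combination of offsets prescribed by
      -- `RegulusPair`.
      plane : ∀ x i {n} j j' → n ≡ offset j' * s i + offset j * t i →
        t i * apply M (affinePt x) j + s i * apply M (affinePt x) j' ≡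
        (t i * mul T x (row j) + s i * mul T x (row j')) + n
      plane x i {n} j j' eq = trans (cong₂ (λ a b → t i * a + s i * b) (apply-affine x j) (apply-affine x j'))
        (trans (shift (s i) (t i) _ _ (offset j') (offset j)) (cong (_ +_) (sym eq)))

    part-common : ∀ {x d} i → Part i → d ∝ direction i → On x i ⇔ CommonR M (atInfinity d) (affinePt x)
    part-common {x} {d} i Ai p@(_ , c≢0 , _) = mk⇔
      (λ (e₁ , e₂) → rulingˡ⇐ c≢0 (st≢0 i) (infinity i p) (trans eq₁ (x≡y⇒x+y≡0 e₁)) (trans eq₂ (x≡y⇒x+y≡0 e₂)))
      (λ r → let (e₁ , e₂) = rulingˡ⇒ c≢0 (st≢0 i) (infinity i p) r
             in x+y≡0⇒x≡y (trans (sym eq₁) e₁) , x+y≡0⇒x≡y (trans (sym eq₂) e₂))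
      where
      eq₁ = plane x i 0F 3F (proj₁ (on-part i Ai))
      eq₂ = plane x i 2F 1F (proj₂ (on-part i Ai))

    part'-common : ∀ {x d} i → Part' i → d ∝ direction i → On x i ⇔ CommonR' M (atInfinity d) (affinePt x)
    part'-common {x} {d} i Bi p@(_ , c≢0 , _) = mk⇔
      (λ (e₁ , e₂) → rulingʳ⇐ c≢0 (st≢0 i) (infinity i p) (trans eq₁ (x≡y⇒x+y≡0 e₁)) (trans eq₂ (x≡y⇒x+y≡0 e₂)))
      (λ r → let (e₁ , e₂) = rulingʳ⇒ c≢0 (st≢0 i) (infinity i p) r
             in x+y≡0⇒x≡y (trans (sym eq₁) e₁) , x+y≡0⇒x≡y (trans (sym eq₂) e₂))
      where
      eq₁ = plane x i 0F 2F (proj₁ (on-part' i Bi))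
      eq₂ = plane x i 3F 1F (proj₂ (on-part' i Bi))

    split-conic : ∀ d → OnConic C d → (𝒜 d ⊎ ℬ d) × ¬ (𝒜 d × ℬ d)
    split-conic d dC = side (parameter d dC) , λ { ((j , Aj , r) , (l , Bl , r')) →
        exclusive j Aj (subst Part' (parameter-unique {d} r' r) Bl) }
      where
      choose : ∀ i → d ∝ direction i → Part i ⊎ Part' i → 𝒜 d ⊎ ℬ d
      choose i p (inj₁ Ai) = inj₁ (i , Ai , p)
      choose i p (inj₂ Bi) = inj₂ (i , Bi , p)
      side : (∃ λ i → d ∝ direction i) → 𝒜 d ⊎ ℬ d
      side (i , p) = choose i p (either i)

    covered : ∀ x → KakeyaSet 𝓛 x ⇔
      (∃ λ d → OnConic C d ×
         ((𝒜 d × CommonR M (atInfinity d) (affinePt x)) ⊎ (ℬ d × CommonR' M (atInfinity d) (affinePt x))))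
    covered x = mk⇔ forth back
      where
      Covered : Vec 3 → Set
      Covered d = (𝒜 d × CommonR M (atInfinity d) (affinePt x)) ⊎ (ℬ d × CommonR' M (atInfinity d) (affinePt x))
      forth : KakeyaSet 𝓛 x → ∃ λ d → OnConic C d × Covered d
      forth K = side (Kakeya⇒On {x} K)
        where
        choose : ∀ i → On x i → Part i ⊎ Part' i → ∃ λ d → OnConic C d × Covered d
        choose i o (inj₁ Ai) = direction i , onConic i ∝-refl ,
          inj₁ ((i , Ai , ∝-refl) , Equivalence.to (part-common {x} {direction i} i Ai ∝-refl) o)
        choose i o (inj₂ Bi) = direction i , onConic i ∝-refl ,
          inj₂ ((i , Bi , ∝-refl) , Equivalence.to (part'-common {x} {direction i} i Bi ∝-refl) o)
        side : (∃ λ i → On x i) → ∃ λ d → OnConic C d × Covered d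
        side (i , o) = choose i o (either i)
      back : (∃ λ d → OnConic C d × Covered d) → KakeyaSet 𝓛 x
      back (d , _ , inj₁ ((i , Ai , p) , r)) = On⇒Kakeya {x} i (Equivalence.from (part-common {x} {d} i Ai p) r)
      back (d , _ , inj₂ ((i , Bi , p) , r)) = On⇒Kakeya {x} i (Equivalence.from (part'-common {x} {d} i Bi p) r)

    conclusion :
      ∃ λ (M : Mat4) → Invertible M
      × (∀ d → NonZero d → (hyp (apply M (atInfinity d)) ≡ 0# ⇔ form C d ≡ 0#))
      × ∃ λ (A : Vec 3 → Set) → ∃ λ (B : Vec 3 → Set) →
      (∀ d d' → d ∝ d' → (A d → A d') × (B d → B d'))
      × (∀ d → (A d → OnConic C d) × (B d → OnConic C d))
      × (∀ d → OnConic C d → (A d ⊎ B d) × ¬ (A d × B d))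
      × (∀ x → KakeyaSet 𝓛 x ⇔
      (∃ λ d → OnConic C d ×
      ((A d × CommonR M (atInfinity d) (affinePt x))
      ⊎ (B d × CommonR' M (atInfinity d) (affinePt x)))))
    conclusion = M , invertible , (λ d _ → conic-at-infinity d) , 𝒜 , ℬ ,
      (λ d d' p → (λ (i , Ai , r) → i , Ai , ∝-trans (∝-sym p) r) , (λ (i , Bi , r) → i , Bi , ∝-trans (∝-sym p) r)) ,
      (λ d → (λ (i , _ , r) → onConic i r) , (λ (i , _ , r) → onConic i r)) ,
      split-conic , covered

theorem3p5 : (q h : ℕ) → q ≡ 2 ^ suc h → (𝔽 : FiniteField q) →
    let open Geom 𝔽 in
    (C : TernaryForm) → NonSingular C →
    (𝓛 : AffLine → Set) → IsKakeyaLineSet C 𝓛 →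
    (xs : List (Vec 3)) → Enumerates (KakeyaSet 𝓛) xs →
    4 ℕ.* length xs ℕ.+ 4 ℕ.< 3 ℕ.* q ℕ.* q ℕ.+ 4 ℕ.* q →
    ∃ λ (M : Mat4) → Invertible M
    × (∀ d → NonZero d → (hyp (apply M (atInfinity d)) ≡ 0# ⇔ form C d ≡ 0#))
    × ∃ λ (A : Vec 3 → Set) → ∃ λ (B : Vec 3 → Set) →
    (∀ d d' → d ∝ d' → (A d → A d') × (B d → B d'))
    × (∀ d → (A d → OnConic C d) × (B d → OnConic C d))
    × (∀ d → OnConic C d → (A d ⊎ B d) × ¬ (A d × B d))
    × (∀ x → KakeyaSet 𝓛 x ⇔
    (∃ λ d → OnConic C d ×
    ((A d × CommonR M (atInfinity d) (affinePt x))
    ⊎ (B d × CommonR' M (atInfinity d) (affinePt x)))))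
theorem3p5 q h q≡ 𝔽 C nonSingular 𝓛 isKakeya xs enumerates few =
  TwoReguli.conclusion (regulus-pair xs enumerates few)
  where
  F = ConicFrames.frame 𝔽 h q≡ C nonSingular
  open Geom 𝔽
  open KakeyaLines 𝔽 h q≡ using (∝-refl; module Conic)
  open Conic F using (direction; onConic)
  -- One representative is fixed for each of the q + 1 parameters, which replaces the predicate 𝓛 by
  -- a finite family that can be counted.
  member : ∀ i → ∃ λ ℓ → 𝓛 ℓ × dir ℓ ∝ direction i
  member i = proj₁ (proj₂ isKakeya) (direction i) (onConic i ∝-refl)
  open KakeyaFamily 𝔽 h q≡ F isKakeya
    (λ i → proj₁ (member i)) (λ i → proj₁ (proj₂ (member i))) (λ i → proj₂ (proj₂ (member i)))
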